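{- Let $(\mathbf r,\mathbf h)$ be a pattern, with $\mathbf r=(r_1,\dots,r_t)$ and $\mathbf h=(h_1,\dots,h_t)$, set $B=\sum_{j=1}^t h_j|r_j|$, and let $n\ge 2$ be an integer with $\gcd(n,r_1\cdots r_t)=1$. If $d$ is a positive divisor of $n$ with $d<n$, and $q=n/d$, then $$T^{(n;d)}_{\mathbf r,\mathbf h}(\alpha_{1,n},\dots,\alpha_{n-1,n})=\sum_{M=-B}^{B}\mathsf S_M(\mathbf r,\mathbf h)\,c_q(M).$$
   Context: A pattern $(\mathbf r,\mathbf h)$ consists of an integer $t\ge 1$, a tuple $\mathbf r=(r_1,\dots,r_t)$ of nonzero integers with $r_1=1$, and a tuple $\mathbf h=(h_1,\dots,h_t)$ of nonnegative integers. For $n\ge 2$ put $\Omega_n=\{1,\dots,n-1\}$ and $\alpha_{k,n}=\cos(2\pi k/n)$ for $k\in\Omega_n$. For an integer $r$ with $\gcd(r,n)=1$, let $\sigma_r:\Omega_n\to\Omega_n$ be the permutation determined by $\sigma_r(k)\equiv rk\pmod n$. For $d\mid n$, $d<n$, put $\mathcal O_d(n)=\{k\in\Omega_n:\gcd(k,n)=d\}$ and, when $\gcd(n,r_1\cdots r_t)=1$, $$T^{(n;d)}_{\mathbf r,\mathbf h}(x_1,\dots,x_{n-1})=\sum_{k\in\mathcal O_d(n)}\prod_{j=1}^t\bigl(2x_{\sigma_{r_j}(k)}\bigr)^{h_j}.$$ $\mathsf S_M(\mathbf r,\mathbf h)$ denotes the coefficient of $u^M$ in the Laurent polynomial $\prod_{j=1}^t(u^{r_j}+u^{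 -r_j})^{h_j}$. The Ramanujan sum is $c_q(M)=\sum_{u\in(\mathbb{Z}/q\mathbb{Z})^\ast}e^{2\pi i Mu/q}$. -}

module Defs where

open import Level using (_⊔_) renaming (suc to lsuc)
open import Algebra.Bundles using (CommutativeRing; RawRing; Semiring)
open import Algebra.Apartness.Bundles using (HeytingField; HeytingCommutativeRing)
import Algebra.Definitions.RawSemiring as RawSemiringDefs
import Algebra.Properties.Ring as RingProperties
import Algebra.Properties.Semiring.Mult as SemiringMult
import Algebra.Solver.Ring as RingSolver
open import Algebra.Solver.Ring.AlmostCommutativeRing
  using (fromCommutativeRing; _-Raw-AlmostCommutative⟶_)
open import Data.Empty using (⊥-elim)
open import Data.Fin.Base as Fin using (Fin; toℕ; fromℕ<)
import Data.Fin.Properties as Fin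
open import Data.Integer.Base as ℤ using (ℤ; +_; -[1+_]; 0ℤ; 1ℤ)
import Data.Integer.Properties as ℤ
import Data.Integer.DivMod as ℤ
import Data.Integer.GCD as ℤ
open import Data.List.Base as List using (List; []; _∷_)
open import Data.Maybe.Base using (Maybe; just; nothing)
open import Data.Nat.Base as ℕ using (ℕ; zero; suc; NonZero; NonTrivial; _!; z≤n; s≤s)
import Data.Nat.Properties as ℕ
import Data.Nat.GCD as ℕ
import Data.Nat.Coprimality as ℕ
import Data.Nat.Divisibility as ℕ
open import Data.Nat.Divisibility using (_∣_; divides)
import Data.Nat.Tactic.RingSolver as ℕ using (solve-∀)
open import Data.Product.Base using (_×_; _,_; proj₁; proj₂; ∃-syntax)
open import Data.Sum.Base using (_⊎_; inj₁; inj₂)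
open import Data.Vec.Functional using (Vector; foldr)
open import Function.Bundles using (_⇔_; module Equivalence)
open import Relation.Binary.Core using (Rel)
open import Relation.Binary.Structures using (IsStrictPartialOrder)
open import Relation.Binary.PropositionalEquality as ≡ using (_≡_; _≢_)
open import Relation.Nullary.Decidable using (yes; no; recompute)
open import Relation.Nullary.Negation using (¬_)

-- The length t is  suc t-1, so that t ≥ 1; r_{j+1} is  r j.
record Pattern : Set where
  field
    t-1  : ℕ
    r    : Vector ℤ (suc t-1)
    r≢0  : ∀ j → r j ≢ 0ℤ
    r₁≡1 : r Fin.zero ≡ 1ℤ
    h    : Vector ℕ (suc t-1)

∏ℤ : ∀ {m} → Vector ℤ m → ℤ
∏ℤ = foldr ℤ._*_ 1ℤ

bound : Pattern → ℕ
bound P = foldr ℕ._+_ 0 (λ j → h j ℕ.* ℤ.∣ r j ∣)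
  where open Pattern P

record Ω (n : ℕ) : Set where
  constructor mkΩ
  field
    ⟦_⟧       : ℕ
    .positive : 1 ℕ.≤ ⟦_⟧
    .bounded  : ⟦_⟧ ℕ.< n

open Ω public using (⟦_⟧)

⟦⟧<n : ∀ {n} (k : Ω n) → ⟦ k ⟧ ℕ.< n
⟦⟧<n {n} (mkΩ k _ k<n) = recompute (k ℕ.<? n) k<n

⟦⟧≢0 : ∀ {n} (k : Ω n) → NonZero ⟦ k ⟧
⟦⟧≢0 (mkΩ k 1≤k _) = ℕ.>-nonZero (recompute (1 ℕ.≤? k) 1≤k)

allΩ : ∀ n → List (Ω n)
allΩ zero    = []
allΩ (suc m) = List.map (λ i → mkΩ (suc (toℕ i)) (s≤s z≤n) (s≤s (Fin.toℕ<n i))) (List.allFin m)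

residue≢0 : ∀ {n} .{{_ : NonZero n}} (r : ℤ) → ℤ.gcd r (+ n) ≡ 1ℤ →
            (k : Ω n) → (r ℤ.* + ⟦ k ⟧) ℤ.%ℕ n ≢ 0
residue≢0 {n} r c k eq = ℕ.<⇒≱ (⟦⟧<n k) (ℕ.∣⇒≤ {{⟦⟧≢0 k}} n∣k)
  where
  q = (r ℤ.* + ⟦ k ⟧) ℤ./ℕ n
  rk≡qn : r ℤ.* + ⟦ k ⟧ ≡ q ℤ.* + n
  rk≡qn = ≡.trans (ℤ.a≡a%ℕn+[a/ℕn]*n (r ℤ.* + ⟦ k ⟧) n)
    (≡.trans (≡.cong (λ z → + z ℤ.+ q ℤ.* + n) eq) (ℤ.+-identityˡ _))
  n∣rk : n ∣ ℤ.∣ r ∣ ℕ.* ⟦ k ⟧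
  n∣rk = divides ℤ.∣ q ∣ (≡.trans (≡.sym (ℤ.abs-* r (+ ⟦ k ⟧)))
    (≡.trans (≡.cong ℤ.∣_∣ rk≡qn) (ℤ.abs-* q (+ n))))
  n∣k : n ∣ ⟦ k ⟧
  n∣k = ℕ.coprime-divisor {n} {ℤ.∣ r ∣}
          (ℕ.sym (ℕ.gcd≡1⇒coprime (ℤ.+-injective c))) n∣rk

σ : ∀ {n} .{{_ : NonZero n}} (r : ℤ) → .(ℤ.gcd r (+ n) ≡ 1ℤ) → Ω n → Ω n
σ {n} r c k = mkΩ ((r ℤ.* + ⟦ k ⟧) ℤ.%ℕ n) (ℕ.n≢0⇒n>0 (residue≢0 r c k))
                  (ℤ.n%ℕd<d (r ℤ.* + ⟦ k ⟧) n)

∣∏ℤ : ∀ {m} (v : Vector ℤ m) j → ℤ.∣ v j ∣ ∣ ℤ.∣ ∏ℤ v ∣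
∣∏ℤ v Fin.zero    = ≡.subst (ℤ.∣ v Fin.zero ∣ ∣_) (≡.sym (ℤ.abs-* (v Fin.zero) _)) (ℕ.m∣m*n _)
∣∏ℤ v (Fin.suc j) = ≡.subst (ℤ.∣ v (Fin.suc j) ∣ ∣_) (≡.sym (ℤ.abs-* (v Fin.zero) _))
  (ℕ.∣n⇒∣m*n ℤ.∣ v Fin.zero ∣ (∣∏ℤ (λ i → v (Fin.suc i)) j))

coprime-factor : ∀ {m} n (v : Vector ℤ m) → ℤ.gcd (+ n) (∏ℤ v) ≡ 1ℤ →
                 ∀ j → ℤ.gcd (v j) (+ n) ≡ 1ℤ
coprime-factor n v c j = ≡.cong +_ (ℕ.coprime⇒gcd≡1 λ (d∣vj , d∣n) →
  ℕ.gcd≡1⇒coprime (ℤ.+-injective c) (d∣n , ℕ.∣-trans d∣vj (∣∏ℤ v j)))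

𝒪 : (n d : ℕ) → List (Ω n)
𝒪 n d = List.filter (λ k → ℕ.gcd ⟦ k ⟧ n ℕ.≟ d) (allΩ n)

-- The residues u ∈ {0, …, q-1} prime to q represent (ℤ/qℤ)*.
units : (q : ℕ) → List (Fin q)
units q = List.filter (λ u → ℕ.gcd (toℕ u) q ℕ.≟ 1) (List.allFin q)

quotient≢0 : ∀ {n d} .{{_ : NonTrivial n}} (d∣n : d ∣ n) → NonZero (ℕ.quotient d∣n)
quotient≢0 {n} d∣n = ℕ.quotient≢0 d∣n {{ℕ.nonTrivial⇒nonZero n}}

-- A Laurent polynomial is a formal sum of monomials; the pair (e , c)
-- is  c · u^e.  Exponents may repeat, and  coeff  collects like terms.
Laurent : Set
Laurent = List (ℤ × ℤ)

coeff : ℤ → Laurent → ℤ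
coeff M []            = 0ℤ
coeff M ((e , c) ∷ p) with e ℤ.≟ M
... | yes _ = c ℤ.+ coeff M p
... | no  _ = coeff M p

u^_ : ℤ → Laurent
u^ e = (e , 1ℤ) ∷ []

infixl 6 _⊞_
infixl 7 _⊠_
infixr 8 _⊠^_

_⊞_ : Laurent → Laurent → Laurent
_⊞_ = List._++_

_⊠_ : Laurent → Laurent → Laurent
p ⊠ q = List.concatMap (λ (e , c) → List.map (λ (e′ , c′) → e ℤ.+ e′ , c ℤ.* c′) q) p

_⊠^_ : Laurent → ℕ → Laurent
p ⊠^ zero  = u^ 0ℤ
p ⊠^ suc n = p ⊠ p ⊠^ n

𝖲 : Pattern → ℤ → ℤ
𝖲 P M = coeff M (foldr _⊠_ (u^ 0ℤ) (λ j → (u^ (r j) ⊞ u^ (ℤ.- r j)) ⊠^ h j))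
  where open Pattern P

module FromInteger {c ℓ} (R : CommutativeRing c ℓ) where

  open CommutativeRing R
  open RawSemiringDefs (Semiring.rawSemiring semiring) public using () renaming (_×_ to _×′_)
  open RingProperties ring
  open SemiringMult semiring using (×-homo-+; ×1-homo-*)
  open import Relation.Binary.Reasoning.Setoid setoid

  fromℕ : ℕ → Carrier
  fromℕ n = n ×′ 1#

  fromℤ : ℤ → Carrier
  fromℤ (+ n)    = fromℕ n
  fromℤ -[1+ n ] = - fromℕ (suc n)

  fromℤ-neg : ∀ i → fromℤ (ℤ.- i) ≈ - fromℤ i
  fromℤ-neg (+ zero)  = sym -0#≈0#
  fromℤ-neg (+ suc n) = refl
  fromℤ-neg -[1+ n ]  = sym (-‿involutive _)

  private
    cancel : ∀ a b → (1# + a) - (1# + b) ≈ a - b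
    cancel a b = begin
      (1# + a) - (1# + b)       ≈⟨ +-cong (+-comm 1# a) (sym (-‿+-comm 1# b)) ⟩
      (a + 1#) + (- 1# + - b)   ≈⟨ +-assoc a 1# _ ⟩
      a + (1# + (- 1# + - b))   ≈⟨ +-congˡ (sym (+-assoc 1# _ _)) ⟩
      a + ((1# + - 1#) + - b)   ≈⟨ +-congˡ (+-congʳ (-‿inverseʳ 1#)) ⟩
      a + (0# + - b)            ≈⟨ +-congˡ (+-identityˡ _) ⟩
      a - b                     ∎

  fromℤ-⊖ : ∀ m n → fromℤ (m ℤ.⊖ n) ≈ fromℕ m - fromℕ n
  fromℤ-⊖ zero    zero    = sym (-‿inverseʳ 0#)
  fromℤ-⊖ zero    (suc n) = sym (+-identityˡ _)
  fromℤ-⊖ (suc m) zero    = sym (trans (+-congˡ -0#≈0#) (+-identityʳ _))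
  fromℤ-⊖ (suc m) (suc n) = begin
    fromℤ (suc m ℤ.⊖ suc n)     ≡⟨ ≡.cong fromℤ (ℤ.[1+m]⊖[1+n]≡m⊖n m n) ⟩
    fromℤ (m ℤ.⊖ n)             ≈⟨ fromℤ-⊖ m n ⟩
    fromℕ m - fromℕ n           ≈⟨ cancel _ _ ⟨
    fromℕ (suc m) - fromℕ (suc n) ∎

  fromℤ-+ : ∀ i j → fromℤ (i ℤ.+ j) ≈ fromℤ i + fromℤ j
  fromℤ-+ (+ m)    (+ n)    = ×-homo-+ 1# m n
  fromℤ-+ (+ m)    -[1+ n ] = fromℤ-⊖ m (suc n)
  fromℤ-+ -[1+ m ] (+ n)    = trans (fromℤ-⊖ n (suc m)) (+-comm _ _)
  fromℤ-+ -[1+ m ] -[1+ n ] = begin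
    - fromℕ (suc (suc (m ℕ.+ n)))         ≡⟨ ≡.cong (λ z → - fromℕ (suc z)) (≡.sym (ℕ.+-suc m n)) ⟩
    - fromℕ (suc m ℕ.+ suc n)             ≈⟨ -‿cong (×-homo-+ 1# (suc m) (suc n)) ⟩
    - (fromℕ (suc m) + fromℕ (suc n))     ≈⟨ -‿+-comm _ _ ⟨
    - fromℕ (suc m) - fromℕ (suc n)       ∎

  fromℤ-* : ∀ i j → fromℤ (i ℤ.* j) ≈ fromℤ i * fromℤ j
  fromℤ-* (+ m) (+ n) = trans (reflexive (≡.cong fromℤ (≡.sym (ℤ.pos-* m n)))) (×1-homo-* m n)
  fromℤ-* (+ m) -[1+ n ] = begin
    fromℤ (+ m ℤ.* -[1+ n ])       ≡⟨ ≡.cong fromℤ (≡.sym (ℤ.neg-distribʳ-* (+ m) (+ suc n))) ⟩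
    fromℤ (ℤ.- (+ m ℤ.* + suc n))  ≈⟨ fromℤ-neg (+ m ℤ.* + suc n) ⟩
    - fromℤ (+ m ℤ.* + suc n)      ≈⟨ -‿cong (fromℤ-* (+ m) (+ suc n)) ⟩
    - (fromℕ m * fromℕ (suc n))    ≈⟨ -‿distribʳ-* _ _ ⟩
    fromℕ m * - fromℕ (suc n)      ∎
  fromℤ-* -[1+ m ] (+ n) = begin
    fromℤ (-[1+ m ] ℤ.* + n)       ≡⟨ ≡.cong fromℤ (≡.sym (ℤ.neg-distribˡ-* (+ suc m) (+ n))) ⟩
    fromℤ (ℤ.- (+ suc m ℤ.* + n))  ≈⟨ fromℤ-neg (+ suc m ℤ.* + n) ⟩
    - fromℤ (+ suc m ℤ.* + n)      ≈⟨ -‿cong (fromℤ-* (+ suc m) (+ n)) ⟩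
    - (fromℕ (suc m) * fromℕ n)    ≈⟨ -‿distribˡ-* _ _ ⟩
    - fromℕ (suc m) * fromℕ n      ∎
  fromℤ-* -[1+ m ] -[1+ n ] = begin
    fromℕ (suc m ℕ.* suc n)            ≈⟨ ×1-homo-* (suc m) (suc n) ⟩
    a * b                              ≈⟨ -‿involutive _ ⟨
    - - (a * b)                        ≈⟨ -‿cong (-‿distribˡ-* a b) ⟩
    - (- a * b)                        ≈⟨ -‿distribʳ-* (- a) b ⟩
    - a * - b                          ∎
    where
    a = fromℕ (suc m)
    b = fromℕ (suc n)

  morphism : CommutativeRing.rawRing ℤ.+-*-commutativeRing
             -Raw-AlmostCommutative⟶ fromCommutativeRing R
  morphism = record
    { ⟦_⟧    = fromℤ
    ; +-homo = fromℤ-+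
    ; *-homo = fromℤ-*
    ; -‿homo = fromℤ-neg
    ; 0-homo = refl
    ; 1-homo = +-identityʳ 1#
    }

  coeff≟ : ∀ i j → Maybe (fromℤ i ≈ fromℤ j)
  coeff≟ i j with i ℤ.≟ j
  ... | yes eq = just (reflexive (≡.cong fromℤ eq))
  ... | no  _  = nothing

  module Solver = RingSolver (CommutativeRing.rawRing ℤ.+-*-commutativeRing)
                             (fromCommutativeRing R) morphism coeff≟

-- The axioms are read constructively; they hold for the Cauchy (or
-- Dedekind) reals and, classically, determine ℝ up to isomorphism.
record CompleteOrderedField c ℓ₁ ℓ₂ : Set (lsuc (c ⊔ ℓ₁ ⊔ ℓ₂)) where
  field
    heytingField : HeytingField c ℓ₁ ℓ₂

  open HeytingField heytingField public

  commutativeRing : CommutativeRing c ℓ₁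
  commutativeRing = HeytingCommutativeRing.commutativeRing heytingCommutativeRing

  open FromInteger commutativeRing public using (fromℕ; fromℤ)

  infix 4 _<_
  field
    _<_                  : Rel Carrier ℓ₂
    isStrictPartialOrder : IsStrictPartialOrder _≈_ _<_
    #⇔<⊎>                : ∀ {x y} → x # y ⇔ (x < y ⊎ y < x)
    +-monoˡ-<            : ∀ {x y} z → x < y → x + z < y + z
    *-pos                : ∀ {x y} → 0# < x → 0# < y → 0# < x * y
    archimedean          : ∀ x → ∃[ n ] x < fromℕ n

  infix 4 _⟶_

  _⟶_ : (ℕ → Carrier) → Carrier → Set (c ⊔ ℓ₂)
  s ⟶ l = ∀ ε → 0# < ε → ∃[ N ] ∀ n → N ℕ.≤ n → (s n - l < ε) × (l - s n < ε)

  -- As m and n may be interchanged, this bounds |s m - s n|.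
  Cauchy : (ℕ → Carrier) → Set (c ⊔ ℓ₂)
  Cauchy s = ∀ ε → 0# < ε → ∃[ N ] ∀ m n → N ℕ.≤ m → N ℕ.≤ n → s m - s n < ε

  field
    complete : ∀ s → Cauchy s → ∃[ l ] s ⟶ l

module Analysis {c ℓ₁ ℓ₂} (ℝ : CompleteOrderedField c ℓ₁ ℓ₂) where

  open CompleteOrderedField ℝ public hiding (zero)
  open CommutativeRing commutativeRing
    using (semiring)
  open FromInteger commutativeRing using (module Solver)
  open Solver using (solve; _:+_; _:*_; _:-_; :-_; _:=_; con)
  open RawSemiringDefs (Semiring.rawSemiring semiring) using (_^_; product)
  open SemiringMult semiring using (×-homo-+; ×1-homo-*)
  open IsStrictPartialOrder isStrictPartialOrder public
    using (<-respˡ-≈; <-respʳ-≈) renaming (trans to <-trans; irrefl to <-irrefl; asym to <-asym)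
  open import Relation.Binary.Reasoning.Setoid (CommutativeRing.setoid commutativeRing)

  <⇒0< : ∀ {x y} → x < y → 0# < y - x
  <⇒0< {x} x<y = <-respˡ-≈ (-‿inverseʳ x) (+-monoˡ-< (- x) x<y)

  -- To prove x < y, exhibit a positive p with y ≈ x + p.
  by : ∀ {x y p} → 0# < p → y ≈ x + p → x < y
  by {x} {y} {p} 0<p eq = <-respˡ-≈ (+-identityˡ x)
    (<-respʳ-≈ (trans (+-comm p x) (sym eq)) (+-monoˡ-< x 0<p))

  0<+ : ∀ {x y} → 0# < x → 0# < y → 0# < x + y
  0<+ {x} {y} 0<x 0<y = <-trans 0<x (by 0<y refl)

  0<1 : 0# < 1#
  0<1 with Equivalence.to #⇔<⊎> (invertible⇒# {1#} {0#} (1# , eq , trans (*-comm _ _) eq))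
    where
    eq : 1# * (1# - 0#) ≈ 1#
    eq = trans (*-identityˡ _) (solve 1 (λ a → a :- con 0ℤ := a) refl 1#)
  ... | inj₂ 0<1 = 0<1
  ... | inj₁ 1<0 = ⊥-elim (<-asym 1<0 (<-respʳ-≈ eq (*-pos p p)))
    where
    p : 0# < 0# - 1#
    p = <⇒0< 1<0
    eq : (0# - 1#) * (0# - 1#) ≈ 1#
    eq = trans (solve 1 (λ a → (con 0ℤ :- a) :* (con 0ℤ :- a) := a :* a) refl 1#) (*-identityˡ 1#)

  fromℕ-pos : ∀ m .{{_ : NonZero m}} → 0# < fromℕ m
  fromℕ-pos (suc zero)      = <-respʳ-≈ (sym (+-identityʳ 1#)) 0<1
  fromℕ-pos (suc m@(suc _)) = 0<+ 0<1 (fromℕ-pos m)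

  fromℕ-+ : ∀ m n → fromℕ (m ℕ.+ n) ≈ fromℕ m + fromℕ n
  fromℕ-+ = ×-homo-+ 1#

  fromℕ-* : ∀ m n → fromℕ (m ℕ.* n) ≈ fromℕ m * fromℕ n
  fromℕ-* = ×1-homo-*

  <fromℕ-mono : ∀ {x m n} → m ℕ.≤ n → x < fromℕ m → x < fromℕ n
  <fromℕ-mono {x} {m} {n} m≤n x<m = ≡.subst (λ k → x < fromℕ k) (ℕ.m∸n+n≡m m≤n) (go (n ℕ.∸ m))
    where
    go : ∀ k → x < fromℕ (k ℕ.+ m)
    go zero    = x<m
    go (suc k) = <-trans (go k) (by 0<1 (+-comm _ _))

  recip-fromℕ′ : ∀ m .{{_ : NonZero m}} → ∃[ y ] fromℕ m * y ≈ 1#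
  recip-fromℕ′ m = y , trans (*-congʳ eq) m*y≈1
    where
    inv = #⇒invertible (Equivalence.from #⇔<⊎> (inj₂ (fromℕ-pos m)))
    y = proj₁ inv
    m*y≈1 = proj₂ (proj₂ inv)
    eq : fromℕ m ≈ fromℕ m - 0#
    eq = solve 1 (λ a → a := a :- con 0ℤ) refl (fromℕ m)

  -- The convergence and inverse proofs are abstract to keep them from
  -- unfolding; m*1/m and series-limit characterise the values.
  abstract
    recip-fromℕ : ∀ m .{{_ : NonZero m}} → ∃[ y ] fromℕ m * y ≈ 1#
    recip-fromℕ m = recip-fromℕ′ m

  infix 9 1/_
  1/_ : ∀ m .{{_ : NonZero m}} → Carrier
  1/ m = proj₁ (recip-fromℕ m)

  m*1/m : ∀ m .{{_ : NonZero m}} → fromℕ m * 1/ m ≈ 1#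
  m*1/m m = proj₂ (recip-fromℕ m)

  inverse-pos : ∀ {x y} → 0# < x → x * y ≈ 1# → 0# < y
  inverse-pos {x} {y} 0<x xy≈1
    with Equivalence.to #⇔<⊎> (invertible⇒# {y} {0#}
           (x , trans eq₁ xy≈1 , trans (*-comm _ x) (trans eq₁ xy≈1)))
    where
    eq₁ : x * (y - 0#) ≈ x * y
    eq₁ = solve 2 (λ a b → a :* (b :- con 0ℤ) := a :* b) refl x y
  ... | inj₂ 0<y = 0<y
  ... | inj₁ y<0 = ⊥-elim (<-asym 0<1 (by (*-pos 0<x (<⇒0< y<0)) (begin
      0#                         ≈⟨ solve 2 (λ a b → con 0ℤ := a :* b :+ a :* (con 0ℤ :- b)) refl x y ⟩
      x * y + x * (0# - y)       ≈⟨ +-congʳ xy≈1 ⟩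
      1# + x * (0# - y)          ∎)))

  1/-pos : ∀ m .{{_ : NonZero m}} → 0# < 1/ m
  1/-pos m = inverse-pos (fromℕ-pos m) (m*1/m m)

  *-monoˡ-< : ∀ {x y} z → 0# < z → x < y → z * x < z * y
  *-monoˡ-< {x} {y} z 0<z x<y = by (*-pos 0<z (<⇒0< x<y))
    (solve 3 (λ x y z → z :* y := z :* x :+ z :* (y :- x)) refl x y z)

  halve : ∀ {x} → 0# < x + x → 0# < x
  halve {x} 0<2x = <-respʳ-≈ eq (*-pos (1/-pos 2) 0<2x)
    where
    eq : 1/ 2 * (x + x) ≈ x
    eq = begin
      1/ 2 * (x + x)          ≈⟨ solve 2 (λ h x → h :* (x :+ x) := (con (+ 2) :* h) :* x) refl (1/ 2) x ⟩
      (fromℕ 2 * 1/ 2) * x    ≈⟨ *-congʳ (m*1/m 2) ⟩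
      1# * x                  ≈⟨ *-identityˡ x ⟩
      x                       ∎

  +-mono-< : ∀ {a b x y} → a < b → x < y → a + x < b + y
  +-mono-< {a} {b} {x} {y} a<b x<y = by (0<+ (<⇒0< a<b) (<⇒0< x<y))
    (solve 4 (λ a b x y → b :+ y := (a :+ x) :+ ((b :- a) :+ (y :- x))) refl a b x y)

  -- Bdd x b  is |x| < b; an absolute value is not assumed.
  Bdd : Carrier → Carrier → Set ℓ₂
  Bdd x b = (x < b) × (- x < b)

  Bdd-resp : ∀ {x y a b} → x ≈ y → a ≈ b → Bdd x a → Bdd y b
  Bdd-resp x≈y a≈b (p , q) = <-respˡ-≈ x≈y (<-respʳ-≈ a≈b p) ,
                             <-respˡ-≈ (-‿cong x≈y) (<-respʳ-≈ a≈b q)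

  Bdd-neg : ∀ {x a} → Bdd x a → Bdd (- x) a
  Bdd-neg {x} (p , q) = q , <-respˡ-≈ (solve 1 (λ x → x := :- (:- x)) refl x) p

  Bdd-+ : ∀ {x y a b} → Bdd x a → Bdd y b → Bdd (x + y) (a + b)
  Bdd-+ {x} {y} (p , q) (p′ , q′) = +-mono-< p p′ ,
    <-respˡ-≈ (solve 2 (λ x y → (:- x) :+ (:- y) := :- (x :+ y)) refl x y) (+-mono-< q q′)

  Bdd-* : ∀ {x y a b} → Bdd x a → Bdd y b → Bdd (x * y) (a * b)
  Bdd-* {x} {y} {a} {b} X@(p , q) Y = upper X Y , <-respˡ-≈ (sym (neg-* x y)) (upper (Bdd-neg X) Y)
    where
    neg-* : ∀ x y → - (x * y) ≈ (- x) * y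
    neg-* = solve 2 (λ x y → :- (x :* y) := (:- x) :* y) refl
    upper : ∀ {x y} → Bdd x a → Bdd y b → x * y < a * b
    upper {x} {y} (p , q) (p′ , q′) = by (halve (<-respʳ-≈ eq
      (0<+ (*-pos (<⇒0< p) (<⇒0< q′)) (*-pos (<⇒0< q) (<⇒0< p′)))))
      (solve 2 (λ u v → v := u :+ (v :- u)) refl (x * y) (a * b))
      where
      eq : (a - x) * (b - (- y)) + (a - (- x)) * (b - y) ≈ (a * b - x * y) + (a * b - x * y)
      eq = solve 4 (λ x y a b → (a :- x) :* (b :- (:- y)) :+ (a :- (:- x)) :* (b :- y)
                     := (a :* b :- x :* y) :+ (a :* b :- x :* y)) refl x y a b

  Bdd⇒pos : ∀ {x b} → Bdd x b → 0# < b
  Bdd⇒pos {x} (p , q) = halve (<-respˡ-≈ (-‿inverseʳ x) (+-mono-< p q))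

  Bdd-mono : ∀ {x m n} → m ℕ.≤ n → Bdd x (fromℕ m) → Bdd x (fromℕ n)
  Bdd-mono m≤n (p , q) = <fromℕ-mono m≤n p , <fromℕ-mono m≤n q

  Bdd-scale : ∀ {x b} z → 0# < z → Bdd x b → Bdd (z * x) (z * b)
  Bdd-scale {x} z 0<z (p , q) = *-monoˡ-< z 0<z p ,
    <-respˡ-≈ (solve 2 (λ z x → z :* (:- x) := :- (z :* x)) refl z x) (*-monoˡ-< z 0<z q)

  bounded : ∀ x → ∃[ N ] Bdd x (fromℕ N)
  bounded x = let (m , x<m) = archimedean x ; (n , -x<n) = archimedean (- x) in
    m ℕ.+ n , <fromℕ-mono (ℕ.m≤m+n m n) x<m , <fromℕ-mono (ℕ.m≤n+m n m) -x<n

  partialSum : (ℕ → Carrier) → ℕ → Carrier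
  partialSum t zero    = 0#
  partialSum t (suc n) = partialSum t n + t n

  partialSum-neg : ∀ t n → partialSum (λ k → - t k) n ≈ - partialSum t n
  partialSum-neg t zero    = solve 0 (con 0ℤ := :- con 0ℤ) refl
  partialSum-neg t (suc n) = trans (+-congʳ (partialSum-neg t n))
    (solve 2 (λ a b → (:- a) :+ (:- b) := :- (a :+ b)) refl _ _)

  module _ where
    -- g k  is 2⁻ᵏ.
    g : ℕ → Carrier
    g k = (1/ (2 ℕ.^ k)) {{ℕ.m^n≢0 2 k}}

    g-pos : ∀ k → 0# < g k
    g-pos k = 1/-pos (2 ℕ.^ k) {{ℕ.m^n≢0 2 k}}

    2^k*g : ∀ k → fromℕ (2 ℕ.^ k) * g k ≈ 1#
    2^k*g k = m*1/m (2 ℕ.^ k) {{ℕ.m^n≢0 2 k}}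

    g-suc : ∀ k → g (suc k) + g (suc k) ≈ g k
    g-suc k = begin
      g′ + g′                         ≈⟨ *-identityˡ _ ⟨
      1# * (g′ + g′)                  ≈⟨ *-congʳ (2^k*g k) ⟨
      (P * g k) * (g′ + g′)           ≈⟨ solve 3 (λ P a b → (P :* a) :* (b :+ b)
                                            := ((con (+ 2) :* P) :* b) :* a) refl P (g k) g′ ⟩
      ((fromℕ 2 * P) * g′) * g k      ≈⟨ *-congʳ (*-congʳ (fromℕ-* 2 (2 ℕ.^ k))) ⟨
      (fromℕ (2 ℕ.^ suc k) * g′) * g k ≈⟨ *-congʳ (2^k*g (suc k)) ⟩
      1# * g k                        ≈⟨ *-identityˡ _ ⟩
      g k                             ∎
      where
      g′ = g (suc k)
      P  = fromℕ (2 ℕ.^ k)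

  n<2^n : ∀ n → n ℕ.< 2 ℕ.^ n
  n<2^n zero    = s≤s z≤n
  n<2^n (suc n) = ℕ.≤-trans (ℕ.+-mono-≤ (ℕ.m^n>0 2 n) (n<2^n n))
    (ℕ.≤-reflexive (≡.cong (2 ℕ.^ n ℕ.+_) (≡.sym (ℕ.+-identityʳ (2 ℕ.^ n)))))

  -- |2ᵏ tₖ| < D for all k
  Geometric : (ℕ → Carrier) → Set ℓ₂
  Geometric t = ∃[ D ] ∀ k → Bdd (fromℕ (2 ℕ.^ k) * t k) (fromℕ D)

  module _ (t : ℕ → Carrier) (D : Carrier) (0<D : 0# < D)
           (t< : ∀ k → t k < D * g k) where

    private
      s = partialSum t
      u : ℕ → Carrier
      u n = s n + (D * g n + D * g n)

      u-step : ∀ n → u (suc n) < u n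
      u-step n = by (<⇒0< (t< n)) (begin
        s n + (D * g n + D * g n)
          ≈⟨ solve 3 (λ s t d → s :+ (d :+ d) := (s :+ t :+ d) :+ (d :- t)) refl (s n) (t n) (D * g n) ⟩
        (s n + t n + D * g n) + (D * g n - t n)
          ≈⟨ +-congʳ (+-congˡ (*-congˡ (g-suc n))) ⟨
        (s n + t n + D * (g (suc n) + g (suc n))) + (D * g n - t n)
          ≈⟨ +-congʳ (+-congˡ (distribˡ D _ _)) ⟩
        u (suc n) + (D * g n - t n) ∎)

      u-bound : ∀ m {z} → u m < z → ∀ j → u (j ℕ.+ m) < z
      u-bound m um<z zero    = um<z
      u-bound m um<z (suc j) = <-trans (u-step (j ℕ.+ m)) (u-bound m um<z j)

    tail-upper : ∀ m n → m ℕ.≤ n → s n < s m + (D * g m + D * g m + D * g m)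
    tail-upper m n m≤n = ≡.subst (λ k → s k < s m + (D * g m + D * g m + D * g m)) (ℕ.m∸n+n≡m m≤n)
      (<-trans (by (0<+ (Dg-pos k) (Dg-pos k)) refl)
               (u-bound m (by (Dg-pos m) (sym (+-assoc _ _ _))) (n ℕ.∸ m)))
      where
      k = n ℕ.∸ m ℕ.+ m
      Dg-pos : ∀ k → 0# < D * g k
      Dg-pos k = *-pos 0<D (g-pos k)

  geometric⇒cauchy′ : ∀ t → Geometric t → Cauchy (partialSum t)
  geometric⇒cauchy′ t (D′ , bd) ε 0<ε = L , λ m n L≤m L≤n → close m n L≤m L≤n
    where
    D = fromℕ D′
    0<D : 0# < D
    0<D = Bdd⇒pos (bd 0)

    unscale : ∀ k → Bdd (t k) (D * g k)
    unscale k = Bdd-resp eq (*-comm _ _) (Bdd-scale (g k) (g-pos k) (bd k))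
      where
      eq : g k * (fromℕ (2 ℕ.^ k) * t k) ≈ t k
      eq = trans (solve 3 (λ a b c → a :* (b :* c) := (b :* a) :* c) refl (g k) _ (t k))
                 (trans (*-congʳ (2^k*g k)) (*-identityˡ _))

    ε⁻¹ : ∃[ y ] ε * y ≈ 1#
    ε⁻¹ = let (y , _ , eq) = #⇒invertible {ε} {0#} (Equivalence.from #⇔<⊎> (inj₂ 0<ε)) in
      y , trans (*-congʳ (solve 1 (λ a → a := a :- con 0ℤ) refl ε)) eq
    y = proj₁ ε⁻¹
    arch = archimedean (fromℕ 6 * D * y)
    L = proj₁ arch

    6Dg<ε : fromℕ 6 * D * g L < ε
    6Dg<ε = <-respˡ-≈ eq₁ (<-respʳ-≈ eq₂
      (*-monoˡ-< (ε * g L) (*-pos 0<ε (g-pos L)) (<fromℕ-mono (ℕ.<⇒≤ (n<2^n L)) (proj₂ arch))))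
      where
      eq₁ : (ε * g L) * (fromℕ 6 * D * y) ≈ fromℕ 6 * D * g L
      eq₁ = begin
        (ε * g L) * (fromℕ 6 * D * y)   ≈⟨ solve 4 (λ e g d y → (e :* g) :* (d :* y) := (e :* y) :* (d :* g))
                                             refl ε (g L) (fromℕ 6 * D) y ⟩
        (ε * y) * (fromℕ 6 * D * g L)   ≈⟨ *-congʳ (proj₂ ε⁻¹) ⟩
        1# * (fromℕ 6 * D * g L)        ≈⟨ *-identityˡ _ ⟩
        fromℕ 6 * D * g L               ∎
      eq₂ : (ε * g L) * fromℕ (2 ℕ.^ L) ≈ ε
      eq₂ = trans (*-assoc _ _ _) (trans (*-congˡ (trans (*-comm _ _) (2^k*g L))) (*-identityʳ ε))

    s = partialSum t
    d = D * g L

    upper : ∀ n → L ℕ.≤ n → s n < s L + (d + d + d)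
    upper = tail-upper t D 0<D (λ k → proj₁ (unscale k)) L

    lower : ∀ n → L ℕ.≤ n → - s n < - s L + (d + d + d)
    lower n L≤n = <-respˡ-≈ (partialSum-neg t n) (<-respʳ-≈ (+-congʳ (partialSum-neg t L))
      (tail-upper (λ k → - t k) D 0<D (λ k → proj₂ (unscale k)) L n L≤n))

    close : ∀ m n → L ℕ.≤ m → L ℕ.≤ n → s m - s n < ε
    close m n L≤m L≤n = <-trans (+-mono-< (upper m L≤m) (lower n L≤n)) (<-respˡ-≈ eq 6Dg<ε)
      where
      eq : fromℕ 6 * D * g L ≈ (s L + (d + d + d)) + (- s L + (d + d + d))
      eq = solve 3 (λ D g s → con (+ 6) :* D :* g
             := (s :+ (D :* g :+ D :* g :+ D :* g)) :+ ((:- s) :+ (D :* g :+ D :* g :+ D :* g)))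
             refl D (g L) (s L)

  abstract
    geometric⇒cauchy : ∀ t → Geometric t → Cauchy (partialSum t)
    geometric⇒cauchy = geometric⇒cauchy′

  series : ∀ t → Geometric t → Carrier
  series t geo = proj₁ (complete (partialSum t) (geometric⇒cauchy t geo))

  series-limit : ∀ t geo → partialSum t ⟶ series t geo
  series-limit t geo = proj₂ (complete (partialSum t) (geometric⇒cauchy t geo))

  K^k≤C*k! : ∀ K .{{_ : NonZero K}} k → K ℕ.^ k ℕ.≤ K ℕ.^ K ℕ.* k !
  K^k≤C*k! K zero    = ℕ.≤-trans (ℕ.m^n>0 K K) (ℕ.≤-reflexive (≡.sym (ℕ.*-identityʳ _)))
  K^k≤C*k! K (suc k) with suc k ℕ.≤? K
  ... | yes k<K = ℕ.≤-trans (ℕ.^-monoʳ-≤ K k<K) (ℕ.m≤m*n (K ℕ.^ K) (suc k !) {{suc k ℕ.!≢0}})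
  ... | no  k≮K = begin′
    where
    eq : ∀ a b c → a ℕ.* (b ℕ.* c) ≡ b ℕ.* (a ℕ.* c)
    eq = ℕ.solve-∀
    begin′ : K ℕ.* K ℕ.^ k ℕ.≤ K ℕ.^ K ℕ.* (suc k ℕ.* k !)
    begin′ = ℕ.≤-trans (ℕ.*-mono-≤ (ℕ.<⇒≤ (ℕ.≰⇒> k≮K)) (K^k≤C*k! K k))
               (ℕ.≤-reflexive (eq (suc k) (K ℕ.^ K) (k !)))

  term-bound : ∀ k m .{{_ : NonZero m}} {y b D} → Bdd y (fromℕ b) →
               2 ℕ.^ k ℕ.* b ℕ.≤ D ℕ.* m → Bdd (fromℕ (2 ℕ.^ k) * (1/ m * y)) (fromℕ D)
  term-bound k m {y} {b} {D} yb le = Bdd-resp eq₁ eq₂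
    (Bdd-scale (1/ m) (1/-pos m) (Bdd-mono le
      (Bdd-resp refl (sym (fromℕ-* (2 ℕ.^ k) b))
        (Bdd-scale (fromℕ (2 ℕ.^ k)) (fromℕ-pos (2 ℕ.^ k) {{ℕ.m^n≢0 2 k}}) yb))))
    where
    eq₁ : 1/ m * (fromℕ (2 ℕ.^ k) * y) ≈ fromℕ (2 ℕ.^ k) * (1/ m * y)
    eq₁ = solve 3 (λ a b c → a :* (b :* c) := b :* (a :* c)) refl (1/ m) _ y
    eq₂ : 1/ m * fromℕ (D ℕ.* m) ≈ fromℕ D
    eq₂ = begin
      1/ m * fromℕ (D ℕ.* m)        ≈⟨ *-congˡ (fromℕ-* D m) ⟩
      1/ m * (fromℕ D * fromℕ m)    ≈⟨ solve 3 (λ a b c → a :* (b :* c) := b :* (c :* a)) refl (1/ m) _ _ ⟩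
      fromℕ D * (fromℕ m * 1/ m)    ≈⟨ *-congˡ (m*1/m m) ⟩
      fromℕ D * 1#                  ≈⟨ *-identityʳ _ ⟩
      fromℕ D                       ∎

  sign-bound : ∀ k {y b} → Bdd y b → Bdd ((- 1#) ^ k * y) b
  sign-bound zero    {y} yb = Bdd-resp (sym (*-identityˡ y)) refl yb
  sign-bound (suc k) {y} yb = Bdd-resp
    eq refl (Bdd-neg (sign-bound k yb))
    where
    eq : - ((- 1#) ^ k * y) ≈ (- 1# * (- 1#) ^ k) * y
    eq = trans (-‿cong (sym (*-identityˡ _)))
      (solve 3 (λ e u y → :- (e :* (u :* y)) := ((:- e) :* u) :* y) refl 1# _ y)

  power-bound : ∀ {x N} → Bdd x (fromℕ N) → ∀ j → Bdd (x ^ j) (fromℕ (2 ℕ.* N ℕ.^ j))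
  power-bound         xN zero    = by 0<1 (+-congˡ (+-identityʳ 1#)) , by (0<+ 0<1 (0<+ 0<1 0<1))
    (solve 1 (λ e → e :+ (e :+ con 0ℤ) := (:- e) :+ (e :+ (e :+ e))) refl 1#)
  power-bound {N = N} xN (suc j) = Bdd-resp refl
    (trans (sym (fromℕ-* N _)) (reflexive (≡.cong fromℕ (eq N (N ℕ.^ j)))))
    (Bdd-* xN (power-bound xN j))
    where
    eq : ∀ a b → a ℕ.* (2 ℕ.* b) ≡ 2 ℕ.* (a ℕ.* b)
    eq = ℕ.solve-∀

  ^-distribʳ-* : ∀ a b j → (a ℕ.* b) ℕ.^ j ≡ a ℕ.^ j ℕ.* b ℕ.^ j
  ^-distribʳ-* a b zero    = ≡.refl
  ^-distribʳ-* a b (suc j) = ≡.trans (≡.cong (a ℕ.* b ℕ.*_) (^-distribʳ-* a b j)) (eq a b _ _)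
    where
    eq : ∀ a b x y → a ℕ.* b ℕ.* (x ℕ.* y) ≡ a ℕ.* x ℕ.* (b ℕ.* y)
    eq = ℕ.solve-∀

  factorial-bound : ∀ K .{{_ : NonZero K}} k → 2 ℕ.* K ℕ.^ k ℕ.≤ 2 ℕ.* K ℕ.^ K ℕ.* k !
  factorial-bound K k = ℕ.≤-trans (ℕ.*-monoʳ-≤ 2 (K^k≤C*k! K k))
    (ℕ.≤-reflexive (≡.sym (ℕ.*-assoc 2 (K ℕ.^ K) (k !))))

  -- cos x = Σₖ (-1)ᵏ x²ᵏ / (2k)!
  cosTerm : Carrier → ℕ → Carrier
  cosTerm x k = (1/ ((2 ℕ.* k) !)) {{(2 ℕ.* k) ℕ.!≢0}} * ((- 1#) ^ k * x ^ (2 ℕ.* k))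

  cos-bound : ∀ N K → 2 ℕ.* N ≡ K → .{{_ : NonZero K}} → ∀ k →
              2 ℕ.^ k ℕ.* (2 ℕ.* N ℕ.^ (2 ℕ.* k)) ℕ.≤ 2 ℕ.* K ℕ.^ K ℕ.* (2 ℕ.* k) !
  cos-bound N K 2N≡K k = go (2 ℕ.* k) (ℕ.m≤m+n k (k ℕ.+ 0))
    where
    eq : ∀ a b → a ℕ.* (2 ℕ.* b) ≡ 2 ℕ.* (a ℕ.* b)
    eq = ℕ.solve-∀
    go : ∀ j → k ℕ.≤ j → 2 ℕ.^ k ℕ.* (2 ℕ.* N ℕ.^ j) ℕ.≤ 2 ℕ.* K ℕ.^ K ℕ.* j !
    go j k≤j = ℕ.≤-trans {j = 2 ℕ.^ j ℕ.* (2 ℕ.* N ℕ.^ j)}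
      (ℕ.*-mono-≤ (ℕ.^-monoʳ-≤ 2 k≤j) (ℕ.≤-refl {2 ℕ.* N ℕ.^ j}))
      (ℕ.≤-trans {j = 2 ℕ.* K ℕ.^ j} (ℕ.≤-reflexive
        (≡.trans (eq (2 ℕ.^ j) (N ℕ.^ j)) (≡.cong (2 ℕ.*_)
          (≡.trans (≡.sym (^-distribʳ-* 2 N j)) (≡.cong (ℕ._^ j) 2N≡K)))))
        (factorial-bound K j))

  cosTerm-bound : ∀ x N K → 2 ℕ.* N ≡ K → .{{_ : NonZero K}} → Bdd x (fromℕ N) → ∀ k →
                  Bdd (fromℕ (2 ℕ.^ k) * cosTerm x k) (fromℕ (2 ℕ.* K ℕ.^ K))
  cosTerm-bound x N K 2N≡K xN k =
    term-bound k ((2 ℕ.* k) !) {{(2 ℕ.* k) ℕ.!≢0}}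
      {y = (- 1#) ^ k * x ^ (2 ℕ.* k)} {b = 2 ℕ.* N ℕ.^ (2 ℕ.* k)} {D = 2 ℕ.* K ℕ.^ K}
      (sign-bound k (power-bound xN (2 ℕ.* k))) (cos-bound N K 2N≡K k)

  cosTerm-geometric′ : ∀ x → Geometric (cosTerm x)
  cosTerm-geometric′ x = 2 ℕ.* K ℕ.^ K ,
      cosTerm-bound x (suc N) K ≡.refl (Bdd-mono {m = N} {suc N} (ℕ.n≤1+n N) (proj₂ (bounded x)))
    where
    N = proj₁ (bounded x)
    K = 2 ℕ.* suc N

  abstract
    cosTerm-geometric : ∀ x → Geometric (cosTerm x)
    cosTerm-geometric = cosTerm-geometric′

  cos : Carrier → Carrier
  cos x = series (cosTerm x) (cosTerm-geometric x)

  -- π/2 is the least positive zero of the cosine.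
  record IsPi (π : Carrier) : Set (c ⊔ ℓ₁ ⊔ ℓ₂) where
    field
      0<π        : 0# < π
      cos[π/2]≈0 : cos (π * 1/ 2) ≈ 0#
      least      : ∀ x → 0# < x → x < π * 1/ 2 → ¬ (cos x ≈ 0#)

  record ℂ : Set c where
    constructor _+i_
    field
      re im : Carrier

  open ℂ public

  infix 4 _≈ℂ_

  _≈ℂ_ : Rel ℂ ℓ₁
  z ≈ℂ w = (re z ≈ re w) × (im z ≈ im w)

  ℂ-rawRing : RawRing c ℓ₁
  ℂ-rawRing = record
    { Carrier = ℂ
    ; _≈_     = _≈ℂ_
    ; _+_     = λ z w → (re z + re w) +i (im z + im w)
    ; _*_     = λ z w → (re z * re w - im z * im w) +i (re z * im w + im z * re w)
    ; -_      = λ z → (- re z) +i (- im z)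
    ; 0#      = 0# +i 0#
    ; 1#      = 1# +i 0#
    }

  open RawRing ℂ-rawRing public using () renaming (_*_ to _*ℂ_; _+_ to _+ℂ_; 0# to 0ℂ)
  open RawSemiringDefs (RawRing.rawSemiring ℂ-rawRing) public
    using () renaming (_^_ to _^ℂ_; sum to sumℂ)

  ι : Carrier → ℂ
  ι x = x +i 0#

  ℂpower-bound : ∀ {z N} → Bdd (re z) (fromℕ N) → Bdd (im z) (fromℕ N) → ∀ k →
    Bdd (re (z ^ℂ k)) (fromℕ (2 ℕ.* (2 ℕ.* N) ℕ.^ k)) × Bdd (im (z ^ℂ k)) (fromℕ (2 ℕ.* (2 ℕ.* N) ℕ.^ k))
  ℂpower-bound {N = N} rN iN zero    = power-bound {N = N} rN zero ,
    Bdd-resp refl refl (by 0<2 (sym (+-identityˡ _)) ,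
                        by 0<2 (solve 1 (λ b → b := (:- con 0ℤ) :+ b) refl _))
    where
    0<2 : 0# < fromℕ 2
    0<2 = fromℕ-pos 2
  ℂpower-bound {z} {N} rN iN (suc k) with ℂpower-bound {z} {N} rN iN k
  ... | rb , ib =
      Bdd-resp refl eq (Bdd-+ (Bdd-* rN rb) (Bdd-neg (Bdd-* iN ib))) ,
      Bdd-resp refl eq (Bdd-+ (Bdd-* rN ib) (Bdd-* iN rb))
    where
    B = 2 ℕ.* (2 ℕ.* N) ℕ.^ k
    eq′ : ∀ n b → n ℕ.* (2 ℕ.* b) ℕ.+ n ℕ.* (2 ℕ.* b) ≡ 2 ℕ.* (2 ℕ.* n ℕ.* b)
    eq′ = ℕ.solve-∀
    eq : fromℕ N * fromℕ B + fromℕ N * fromℕ B ≈ fromℕ (2 ℕ.* (2 ℕ.* N) ℕ.^ suc k)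
    eq = begin
      fromℕ N * fromℕ B + fromℕ N * fromℕ B       ≈⟨ +-cong (fromℕ-* N B) (fromℕ-* N B) ⟨
      fromℕ (N ℕ.* B) + fromℕ (N ℕ.* B)           ≈⟨ fromℕ-+ (N ℕ.* B) (N ℕ.* B) ⟨
      fromℕ (N ℕ.* B ℕ.+ N ℕ.* B)                 ≡⟨ ≡.cong fromℕ (eq′ N ((2 ℕ.* N) ℕ.^ k)) ⟩
      fromℕ (2 ℕ.* (2 ℕ.* N) ℕ.^ suc k)           ∎

  -- exp z = Σₖ zᵏ / k!
  expTerm : ℂ → ℕ → ℂ
  expTerm z k = (1/k! * re (z ^ℂ k)) +i (1/k! * im (z ^ℂ k))
    where
    1/k! = (1/ (k !)) {{k ℕ.!≢0}}

  expTerm-bound : ∀ N K → 2 ℕ.* (2 ℕ.* N) ≡ K → .{{_ : NonZero K}} → ∀ k {y} →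
                  Bdd y (fromℕ (2 ℕ.* (2 ℕ.* N) ℕ.^ k)) →
                  Bdd (fromℕ (2 ℕ.^ k) * ((1/ (k !)) {{k ℕ.!≢0}} * y)) (fromℕ (2 ℕ.* K ℕ.^ K))
  expTerm-bound N K 4N≡K k {y} yb =
    term-bound k (k !) {{k ℕ.!≢0}} {y = y} {b = 2 ℕ.* (2 ℕ.* N) ℕ.^ k} {D = 2 ℕ.* K ℕ.^ K} yb
      (ℕ.≤-trans {j = 2 ℕ.* K ℕ.^ k} (ℕ.≤-reflexive (≡.trans (eq (2 ℕ.^ k) ((2 ℕ.* N) ℕ.^ k))
        (≡.cong (2 ℕ.*_) (≡.trans (≡.sym (^-distribʳ-* 2 (2 ℕ.* N) k)) (≡.cong (ℕ._^ k) 4N≡K)))))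
        (factorial-bound K k))
    where
    eq : ∀ x y → x ℕ.* (2 ℕ.* y) ≡ 2 ℕ.* (x ℕ.* y)
    eq = ℕ.solve-∀

  expTerm-geometric′ : ∀ z → Geometric (λ k → re (expTerm z k)) × Geometric (λ k → im (expTerm z k))
  expTerm-geometric′ z =
      (2 ℕ.* K ℕ.^ K , λ k → expTerm-bound N K ≡.refl k (proj₁ (pb k))) ,
      (2 ℕ.* K ℕ.^ K , λ k → expTerm-bound N K ≡.refl k (proj₂ (pb k)))
    where
    a = proj₁ (bounded (re z))
    b = proj₁ (bounded (im z))
    N = suc (a ℕ.+ b)
    K = 2 ℕ.* (2 ℕ.* N)
    pb = ℂpower-bound {z} {N} (Bdd-mono {m = a} {N} (ℕ.m≤n⇒m≤1+n (ℕ.m≤m+n a b)) (proj₂ (bounded (re z))))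
                              (Bdd-mono {m = b} {N} (ℕ.m≤n⇒m≤1+n (ℕ.m≤n+m b a)) (proj₂ (bounded (im z))))

  abstract
    expTerm-geometric : ∀ z → Geometric (λ k → re (expTerm z k)) × Geometric (λ k → im (expTerm z k))
    expTerm-geometric = expTerm-geometric′

  exp : ℂ → ℂ
  exp z = series (λ k → re (expTerm z k)) (proj₁ (expTerm-geometric z))
       +i series (λ k → im (expTerm z k)) (proj₂ (expTerm-geometric z))

  𝖳 : (P : Pattern) (n d : ℕ) .{{_ : NonTrivial n}} →
      .(ℤ.gcd (+ n) (∏ℤ (Pattern.r P)) ≡ 1ℤ) → (Ω n → Carrier) → Carrier
  𝖳 P n d coprime x = List.foldr _+_ 0# (List.map term (𝒪 n d))
    where
    open Pattern P
    instance _ = ℕ.nonTrivial⇒nonZero n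
    term : Ω n → Carrier
    term k = product (λ j → (fromℕ 2 * x (σ (r j) (coprime-factor n r coprime j) k)) ^ h j)

  2π[_]_/_ : (π : Carrier) → ℤ → (q : ℕ) .{{_ : NonZero q}} → Carrier
  2π[ π ] m / q = fromℕ 2 * π * fromℤ m * 1/ q

  α : (π : Carrier) (n : ℕ) .{{_ : NonTrivial n}} → Ω n → Carrier
  α π n k = cos (2π[ π ] (+ ⟦ k ⟧) / n)
    where instance _ = ℕ.nonTrivial⇒nonZero n

  ramanujanSum : (π : Carrier) (q : ℕ) .{{_ : NonZero q}} → ℤ → ℂ
  ramanujanSum π q M =
    List.foldr _+ℂ_ 0ℂ (List.map (λ u → exp (0# +i (2π[ π ] (M ℤ.* + toℕ u) / q))) (units q))

  -- ∑± B f  is the sum of f M over -B ≤ M ≤ B.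
  ∑± : ℕ → (ℤ → ℂ) → ℂ
  ∑± B f = sumℂ {suc (2 ℕ.* B)} (λ i → f (+ toℕ i ℤ.- + B))

module Submission where

-- Put e(θ) = exp(iθ).  The Cauchy product gives e(θ + φ) = e(θ) e(φ), and
-- cos(π/2) = 0 forces e(π/2)² = -1, so e(2π) = 1 and χₙ(m) = e(2πm/n) is an
-- n-periodic character with χₙ(m) + χₙ(-m) = 2 cos(2πm/n).  Hence the product
-- attached to k is the Laurent polynomial ∏ⱼ (u^{rⱼ} + u^{-rⱼ})^{hⱼ} at
-- u = χₙ(k).  Expand it into monomials and sum over k = d u with u prime to
-- q: the monomial u^M contributes Σ χ_q(M u) = c_q(M).

open import Defs
open import Algebra.Bundles using (AbelianGroup; CommutativeMonoid; CommutativeRing; Semiring)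
import Algebra.Definitions.RawSemiring as RawSemiringDefs
import Algebra.Properties.CommutativeMonoid.Sum as CommutativeMonoidSum
import Algebra.Properties.CommutativeSemigroup as CommutativeSemigroupProperties
import Algebra.Properties.CommutativeSemiring.Binomial as Binomial
import Algebra.Properties.CommutativeSemiring.Exp as Exp
import Algebra.Properties.Group as GroupProperties
import Algebra.Properties.Semiring.Mult as SemiringMult
import Algebra.Properties.Semiring.Sum as SemiringSum
open import Algebra.Structures using (IsCommutativeRing)
open import Data.Bool.Base using (if_then_else_)
open import Data.Empty using (⊥)
open import Data.Fin.Base as Fin using (Fin; toℕ; fromℕ<)
import Data.Fin.Properties as Fin
open import Data.Integer.Base as ℤ using (ℤ; +_; -[1+_]; 0ℤ; 1ℤ)
import Data.Integer.DivMod as ℤ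
open import Data.Integer.GCD using (gcd)
import Data.Integer.Properties as ℤ
open import Data.List.Base as List using (List; []; _∷_)
import Data.List.Properties as List
open import Data.List.Relation.Unary.All as All using (All; []; _∷_)
import Data.List.Relation.Unary.All.Properties as All
open import Data.Nat.Base as ℕ using (ℕ; zero; suc; NonZero; NonTrivial; _!; z≤n; s≤s)
open import Data.Nat.Combinatorics using (_C_; nCk≡n!/k![n-k]!; k![n∸k]!∣n!)
open import Data.Nat.Divisibility using (_∣_; divides; quotient)
import Data.Nat.Divisibility as ℕ
open import Data.Nat.DivMod using (m/n*n≡m)
import Data.Nat.GCD as ℕ
import Data.Nat.Properties as ℕ
import Data.Nat.Tactic.RingSolver as ℕ using (solve-∀)
open import Data.Product.Base using (_×_; _,_; proj₁; proj₂; ∃-syntax)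
open import Data.Sum.Base using (inj₂; [_,_]′)
open import Data.Vec.Functional using (foldr)
open import Function.Base using (_∘_)
open import Function.Bundles using (module Equivalence)
open import Level using (_⊔_)
open import Relation.Binary.PropositionalEquality as ≡ using (_≡_; _≢_)
import Relation.Binary.Reasoning.Setoid as SetoidReasoning
open import Relation.Nullary.Decidable using (Dec; does; yes; no)
open import Relation.Nullary.Negation using (¬_; contradiction)
open import Relation.Unary using (Decidable)

-- Limits of real sequences

-- The field is constructive: an absolute value is not given and x ≈ 0 cannot be decided. Smallness
-- is therefore the two-sided bound `Bdd`, and equality of limits is reached by refuting strict
-- inequalities. The main analytic obstacle is the Cauchy product, which needs an explicit rate:
-- from |t k| < D 2⁻ᵏ for both series, its error after n terms is at most a constant times (n + 1)
-- 2⁻ⁿ. Moreover `cos` and `exp` are defined by two separate power series, and `complete` returns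
-- limits without formulas, so the real part of e(θ) has to be identified with cos θ by comparing
-- partial sums.

module Limits {c ℓ₁ ℓ₂} (ℝ : CompleteOrderedField c ℓ₁ ℓ₂) where

  open Analysis ℝ
  open FromInteger commutativeRing using (module Solver)
  open Solver using (solve; con; _:+_; _:*_; _:-_; :-_; _:=_)
  open SetoidReasoning (CommutativeRing.setoid commutativeRing)

  half+half : ∀ x → 1/ 2 * x + 1/ 2 * x ≈ x
  half+half x = begin
    1/ 2 * x + 1/ 2 * x    ≈⟨ solve 2 (λ h x → h :* x :+ h :* x := (con (+ 2) :* h) :* x) refl (1/ 2) x ⟩
    fromℕ 2 * 1/ 2 * x     ≈⟨ *-congʳ (m*1/m 2) ⟩
    1# * x                 ≈⟨ *-identityˡ x ⟩
    x                      ∎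

  half-pos : ∀ {x} → 0# < x → 0# < 1/ 2 * x
  half-pos = *-pos (1/-pos 2)

  Null : (ℕ → Carrier) → Set (c ⊔ ℓ₂)
  Null s = ∀ ε → 0# < ε → ∃[ N ] ∀ n → N ℕ.≤ n → Bdd (s n) ε

  ⟶⇒Null : ∀ {s l} → s ⟶ l → Null (λ n → s n - l)
  ⟶⇒Null {s} {l} s⟶l ε 0<ε with N , close ← s⟶l ε 0<ε = N , λ n N≤n →
    proj₁ (close n N≤n) ,
    <-respˡ-≈ (solve 2 (λ s l → l :- s := :- (s :- l)) refl (s n) l) (proj₂ (close n N≤n))

  Null⇒⟶ : ∀ {s l} → Null (λ n → s n - l) → s ⟶ l
  Null⇒⟶ {s} {l} null ε 0<ε with N , close ← null ε 0<ε = N , λ n N≤n →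
    proj₁ (close n N≤n) ,
    <-respˡ-≈ (solve 2 (λ s l → :- (s :- l) := l :- s) refl (s n) l) (proj₂ (close n N≤n))

  Null-cong : ∀ {s t} → (∀ n → s n ≈ t n) → Null s → Null t
  Null-cong s≈t null ε 0<ε with N , close ← null ε 0<ε =
    N , λ n N≤n → Bdd-resp (s≈t n) refl (close n N≤n)

  ⟶-cong : ∀ {s t l} → (∀ n → s n ≈ t n) → s ⟶ l → t ⟶ l
  ⟶-cong s≈t s⟶l = Null⇒⟶ (Null-cong (λ n → +-congʳ (s≈t n)) (⟶⇒Null s⟶l))

  Null-+ : ∀ {s t} → Null s → Null t → Null (λ n → s n + t n)
  Null-+ s⟶0 t⟶0 ε 0<ε
    with N , s< ← s⟶0 (1/ 2 * ε) (half-pos 0<ε) | M , t< ← t⟶0 (1/ 2 * ε) (half-pos 0<ε) =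
    N ℕ.+ M , λ n N+M≤n → Bdd-resp refl (half+half ε)
      (Bdd-+ (s< n (ℕ.m+n≤o⇒m≤o N N+M≤n)) (t< n (ℕ.m+n≤o⇒n≤o N N+M≤n)))

  Null-neg : ∀ {s} → Null s → Null (λ n → - s n)
  Null-neg null ε 0<ε with N , close ← null ε 0<ε = N , λ n N≤n → Bdd-neg (close n N≤n)

  Null-* : ∀ {s t} → Null s → Null t → Null (λ n → s n * t n)
  Null-* s⟶0 t⟶0 ε 0<ε with N , s< ← s⟶0 ε 0<ε | M , t< ← t⟶0 1# 0<1 =
    N ℕ.+ M , λ n N+M≤n → Bdd-resp refl (*-identityʳ ε)
      (Bdd-* (s< n (ℕ.m+n≤o⇒m≤o N N+M≤n)) (t< n (ℕ.m+n≤o⇒n≤o N N+M≤n)))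

  -- Some natural number m + 1 exceeds |x|, so it is enough that s is within ε / (m + 1). The
  -- successor keeps the divisor nonzero.
  Null-scale : ∀ x {s} → Null s → Null (λ n → x * s n)
  Null-scale x s⟶0 ε 0<ε with m , x<m ← bounded x
    with N , s< ← s⟶0 (1/ suc m * ε) (*-pos (1/-pos (suc m)) 0<ε) =
    N , λ n N≤n → Bdd-resp refl eq (Bdd-* (Bdd-mono {m = m} (ℕ.n≤1+n m) x<m) (s< n N≤n))
    where
    eq : fromℕ (suc m) * (1/ suc m * ε) ≈ ε
    eq = trans (sym (*-assoc _ _ _)) (trans (*-congʳ (m*1/m (suc m))) (*-identityˡ ε))

  ⟶-+ : ∀ {s t l m} → s ⟶ l → t ⟶ m → (λ n → s n + t n) ⟶ (l + m)
  ⟶-+ {s} {t} {l} {m} s⟶l t⟶m = Null⇒⟶ (Null-cong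
    (λ n → solve 4 (λ s t l m → (s :- l) :+ (t :- m) := (s :+ t) :- (l :+ m)) refl (s n) (t n) l m)
    (Null-+ (⟶⇒Null s⟶l) (⟶⇒Null t⟶m)))

  ⟶-neg : ∀ {s l} → s ⟶ l → (λ n → - s n) ⟶ (- l)
  ⟶-neg {s} {l} s⟶l = Null⇒⟶ (Null-cong
    (λ n → solve 2 (λ s l → :- (s :- l) := (:- s) :- (:- l)) refl (s n) l)
    (Null-neg (⟶⇒Null s⟶l)))

  -- In st - lm = (s - l)(t - m) + l(t - m) + m(s - l) every factor is a null sequence or a
  -- constant, so boundedness of convergent sequences is not called upon.
  ⟶-* : ∀ {s t l m} → s ⟶ l → t ⟶ m → (λ n → s n * t n) ⟶ (l * m)
  ⟶-* {s} {t} {l} {m} s⟶l t⟶m = Null⇒⟶ (Null-cong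
    (λ n → solve 4 (λ s t l m → (s :- l) :* (t :- m) :+ (l :* (t :- m) :+ m :* (s :- l))
                      := s :* t :- l :* m) refl (s n) (t n) l m)
    (Null-+ (Null-* s-l t-m) (Null-+ (Null-scale l t-m) (Null-scale m s-l))))
    where
    s-l = ⟶⇒Null {s} s⟶l
    t-m = ⟶⇒Null {t} t⟶m

  ⟶-subsequence : ∀ {s l} {f : ℕ → ℕ} → (∀ n → n ℕ.≤ f n) → s ⟶ l → (λ n → s (f n)) ⟶ l
  ⟶-subsequence {f = f} n≤fn s⟶l ε 0<ε with N , close ← s⟶l ε 0<ε =
    N , λ n N≤n → close (f n) (ℕ.≤-trans N≤n (n≤fn n))

  -- At a late index both s - l and m - s lie below half of m - l, yet they add up to m - l.
  ⟶-≮ : ∀ {s l m} → s ⟶ l → s ⟶ m → l < m → ⊥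
  ⟶-≮ {s} {l} {m} s⟶l s⟶m l<m
    with N , s-l ← s⟶l _ (half-pos (<⇒0< l<m)) | M , s-m ← s⟶m _ (half-pos (<⇒0< l<m)) =
    <-irrefl eq (+-mono-< (proj₁ (s-l (N ℕ.+ M) (ℕ.m≤m+n N M)))
                          (proj₂ (s-m (N ℕ.+ M) (ℕ.m≤n+m M N))))
    where
    eq : (s (N ℕ.+ M) - l) + (m - s (N ℕ.+ M)) ≈ 1/ 2 * (m - l) + 1/ 2 * (m - l)
    eq = trans (solve 3 (λ s l m → (s :- l) :+ (m :- s) := m :- l) refl (s (N ℕ.+ M)) l m)
               (sym (half+half (m - l)))

  -- Apartness is tight: l ≈ m follows once l # m, that is l < m or m < l, is refuted.
  ⟶-unique : ∀ {s l m} → s ⟶ l → s ⟶ m → l ≈ m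
  ⟶-unique {s} {l} {m} s⟶l s⟶m = proj₁ (tight l m) λ l#m →
    [ ⟶-≮ {s} s⟶l s⟶m , ⟶-≮ {s} s⟶m s⟶l ]′ (Equivalence.to #⇔<⊎> l#m)

-- The Cauchy product of geometrically bounded series

module CauchyProduct {c ℓ₁ ℓ₂} (ℝ : CompleteOrderedField c ℓ₁ ℓ₂) where

  open Analysis ℝ
  open Limits ℝ
  open FromInteger commutativeRing using (module Solver)
  open Solver using (solve; con; _:+_; _:*_; _:-_; :-_; _:=_)
  open SetoidReasoning (CommutativeRing.setoid commutativeRing)
  open SemiringSum (CommutativeRing.semiring commutativeRing)

  -- It bounds (n + 1) 2⁻ⁿ by 4/n, the decay rate of the Cauchy product error. In the induction n(n
  -- + 1) grows by 2(n + 1), which is at most 2 · 2ⁿ.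
  n[n+1]<2^[n+2] : ∀ n → n ℕ.* suc n ℕ.< 4 ℕ.* 2 ℕ.^ n
  n[n+1]<2^[n+2] n = ℕ.≤-<-trans (bound′ n)
      (ℕ.*-monoˡ-< (2 ℕ.^ n) {{ℕ.m^n≢0 2 n}} {2} {4} (s≤s (s≤s (s≤s z≤n))))
    where
    bound′ : ∀ n → n ℕ.* suc n ℕ.≤ 2 ℕ.* 2 ℕ.^ n
    bound′ zero    = z≤n
    bound′ (suc n) = ℕ.≤-trans (ℕ.≤-reflexive (eq n)) (ℕ.≤-trans
      (ℕ.+-mono-≤ (bound′ n) (ℕ.*-monoʳ-≤ 2 (n<2^n n))) (ℕ.≤-reflexive (eq′ (2 ℕ.^ n))))
      where
      eq : ∀ n → suc n ℕ.* suc (suc n) ≡ n ℕ.* suc n ℕ.+ 2 ℕ.* suc n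
      eq = ℕ.solve-∀
      eq′ : ∀ x → 2 ℕ.* x ℕ.+ 2 ℕ.* x ≡ 2 ℕ.* (2 ℕ.* x)
      eq′ = ℕ.solve-∀

  fromℕ-mono-< : ∀ {m n} → m ℕ.< n → fromℕ m < fromℕ n
  fromℕ-mono-< m<n = <fromℕ-mono m<n (by 0<1 (+-comm 1# _))

  positive-inverse : ∀ {x} → 0# < x → ∃[ y ] x * y ≈ 1#
  positive-inverse {x} 0<x =
    let (y , _ , eq) = #⇒invertible {x} {0#} (Equivalence.from #⇔<⊎> (inj₂ 0<x)) in
    y , trans (*-congʳ (solve 1 (λ a → a := a :- con 0ℤ) refl x)) eq

  -- With `y` = 1/ε, every n ≥ `N` exceeds 4x/ε, and n(n + 1) < 4 · 2ⁿ then gives (n + 1) x 2⁻ⁿ < ε.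
  n*g-null : ∀ x → 0# < x → Null (λ n → fromℕ (suc n) * x * g n)
  n*g-null x 0<x ε 0<ε with y , εy≈1 ← positive-inverse 0<ε
    with N , 4xy<N ← archimedean (fromℕ 4 * (x * y)) =
    N , λ n N≤n → upper n N≤n , <-trans (0<-neg (pos n)) 0<ε
    where
    pos : ∀ n → 0# < fromℕ (suc n) * x * g n
    pos n = *-pos (*-pos (fromℕ-pos (suc n)) 0<x) (g-pos n)

    0<-neg : ∀ {z} → 0# < z → - z < 0#
    0<-neg {z} 0<z = by 0<z (sym (-‿inverseˡ z))

    upper : ∀ n → N ℕ.≤ n → fromℕ (suc n) * x * g n < ε
    upper n N≤n = <-respʳ-≈ eq₃ (<-trans
      (<-respˡ-≈ eq₁ (<-respʳ-≈ eq₂ (*-monoˡ-< k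
        (*-pos (*-pos (*-pos 0<ε (1/-pos 4)) (g-pos n)) (fromℕ-pos (suc n)))
        (<fromℕ-mono N≤n 4xy<N))))
      (*-monoˡ-< (ε * 1/ 4 * g n) (*-pos (*-pos 0<ε (1/-pos 4)) (g-pos n))
        (fromℕ-mono-< (n[n+1]<2^[n+2] n))))
      where
      -- Multiplying 4x/ε < n by `k` produces the term to be bounded on the left and (ε/4) 2⁻ⁿ n(n +
      -- 1) on the right, which is below ε.
      k = ε * 1/ 4 * g n * fromℕ (suc n)
      eq₁ : k * (fromℕ 4 * (x * y)) ≈ fromℕ (suc n) * x * g n
      eq₁ = begin
        k * (fromℕ 4 * (x * y))
          ≈⟨ solve 7 (λ e q g s f x y → e :* q :* g :* s :* (f :* (x :* y))
               := (e :* y) :* (f :* q) :* (s :* x :* g))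
               refl ε (1/ 4) (g n) (fromℕ (suc n)) (fromℕ 4) x y ⟩
        (ε * y) * (fromℕ 4 * 1/ 4) * (fromℕ (suc n) * x * g n)
          ≈⟨ *-congʳ (*-cong εy≈1 (m*1/m 4)) ⟩
        1# * 1# * (fromℕ (suc n) * x * g n)
          ≈⟨ trans (*-assoc _ _ _) (trans (*-identityˡ _) (*-identityˡ _)) ⟩
        fromℕ (suc n) * x * g n ∎
      eq₂ : k * fromℕ n ≈ ε * 1/ 4 * g n * fromℕ (n ℕ.* suc n)
      eq₂ = begin
        k * fromℕ n
          ≈⟨ solve 3 (λ a b c → a :* b :* c := a :* (c :* b)) refl
               (ε * 1/ 4 * g n) (fromℕ (suc n)) (fromℕ n) ⟩
        ε * 1/ 4 * g n * (fromℕ n * fromℕ (suc n))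
          ≈⟨ *-congˡ (fromℕ-* n (suc n)) ⟨
        ε * 1/ 4 * g n * fromℕ (n ℕ.* suc n) ∎
      eq₃ : ε * 1/ 4 * g n * fromℕ (4 ℕ.* 2 ℕ.^ n) ≈ ε
      eq₃ = begin
        ε * 1/ 4 * g n * fromℕ (4 ℕ.* 2 ℕ.^ n)
          ≈⟨ *-congˡ (fromℕ-* 4 (2 ℕ.^ n)) ⟩
        ε * 1/ 4 * g n * (fromℕ 4 * fromℕ (2 ℕ.^ n))
          ≈⟨ solve 5 (λ e q g f p → e :* q :* g :* (f :* p) := e :* ((f :* q) :* (p :* g))) refl
               ε (1/ 4) (g n) (fromℕ 4) (fromℕ (2 ℕ.^ n)) ⟩
        ε * ((fromℕ 4 * 1/ 4) * (fromℕ (2 ℕ.^ n) * g n))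
          ≈⟨ *-congˡ (*-cong (m*1/m 4) (2^k*g n)) ⟩
        ε * (1# * 1#)
          ≈⟨ trans (*-congˡ (*-identityˡ 1#)) (*-identityʳ ε) ⟩
        ε ∎

  unscale : ∀ {t : ℕ → Carrier} {D} → (∀ k → Bdd (fromℕ (2 ℕ.^ k) * t k) D) → ∀ k → Bdd (t k) (D * g k)
  unscale {t} {D} bd k = Bdd-resp eq (*-comm _ _) (Bdd-scale (g k) (g-pos k) (bd k))
    where
    eq : g k * (fromℕ (2 ℕ.^ k) * t k) ≈ t k
    eq = trans (solve 3 (λ a b c → a :* (b :* c) := (b :* a) :* c) refl (g k) _ (t k))
               (trans (*-congʳ (2^k*g k)) (*-identityˡ _))

  g-+ : ∀ m n → g (m ℕ.+ n) ≈ g m * g n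
  g-+ m n = begin
    g (m ℕ.+ n)                                ≈⟨ trans (*-identityˡ _) (*-identityˡ _) ⟨
    1# * (1# * g (m ℕ.+ n))                    ≈⟨ *-cong (2^k*g m) (*-congʳ (2^k*g n)) ⟨
    (p * g m) * ((q * g n) * g (m ℕ.+ n))
      ≈⟨ solve 5 (λ p q a b c → (p :* a) :* ((q :* b) :* c) := ((p :* q) :* c) :* (a :* b))
           refl p q (g m) (g n) (g (m ℕ.+ n)) ⟩
    ((p * q) * g (m ℕ.+ n)) * (g m * g n)      ≈⟨ *-congʳ (*-congʳ (fromℕ-* (2 ℕ.^ m) (2 ℕ.^ n))) ⟨
    (fromℕ (2 ℕ.^ m ℕ.* 2 ℕ.^ n) * g (m ℕ.+ n)) * (g m * g n)
      ≡⟨ ≡.cong (λ z → fromℕ z * g (m ℕ.+ n) * (g m * g n)) (ℕ.^-distribˡ-+-* 2 m n) ⟨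
    (fromℕ (2 ℕ.^ (m ℕ.+ n)) * g (m ℕ.+ n)) * (g m * g n)
      ≈⟨ *-congʳ (2^k*g (m ℕ.+ n)) ⟩
    1# * (g m * g n)                           ≈⟨ *-identityˡ _ ⟩
    g m * g n                                  ∎
    where
    p = fromℕ (2 ℕ.^ m)
    q = fromℕ (2 ℕ.^ n)

  -- `partialSum` splits off the last term and this sum the first. The induction over shifted
  -- sequences needs the second form, limits are stated with the first.
  ∑ : (ℕ → Carrier) → ℕ → Carrier
  ∑ a n = sum {n} (λ i → a (toℕ i))

  partialSum-suc : ∀ a n → partialSum a (suc n) ≈ a 0 + partialSum (a ∘ suc) n
  partialSum-suc a zero    = +-comm 0# (a 0)
  partialSum-suc a (suc n) = trans (+-congʳ (partialSum-suc a n)) (+-assoc _ _ _)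

  partialSum≈∑ : ∀ a n → partialSum a n ≈ ∑ a n
  partialSum≈∑ a zero    = refl
  partialSum≈∑ a (suc n) = trans (partialSum-suc a n) (+-congˡ (partialSum≈∑ (a ∘ suc) n))

  infixl 7 _⋆_
  _⋆_ : (ℕ → Carrier) → (ℕ → Carrier) → ℕ → Carrier
  (a ⋆ b) k = sum {suc k} (λ i → a (toℕ i) * b (k ℕ.∸ toℕ i))

  -- The index pairs (0, j) contribute a₀ times a partial sum of b; the remaining pairs form the
  -- same triangle, one size smaller, for the shifted a.
  ∑-⋆-suc : ∀ a b n → ∑ (a ⋆ b) (suc n) ≈ a 0 * ∑ b (suc n) + ∑ ((a ∘ suc) ⋆ b) n
  ∑-⋆-suc a b n = begin
    (a 0 * b 0 + 0#) + sum {n} (λ i → a 0 * b (suc (toℕ i)) + ((a ∘ suc) ⋆ b) (toℕ i))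
      ≈⟨ +-cong (+-identityʳ _)
           (∑-distrib-+ {n} (λ i → a 0 * b (suc (toℕ i))) (λ i → ((a ∘ suc) ⋆ b) (toℕ i))) ⟩
    a 0 * b 0 + (sum {n} (λ i → a 0 * b (suc (toℕ i))) + ∑ ((a ∘ suc) ⋆ b) n)
      ≈⟨ +-congˡ (+-congʳ (*-distribˡ-sum {n} (a 0) (λ i → b (suc (toℕ i))))) ⟨
    a 0 * b 0 + (a 0 * ∑ (b ∘ suc) n + ∑ ((a ∘ suc) ⋆ b) n)
      ≈⟨ +-assoc _ _ _ ⟨
    (a 0 * b 0 + a 0 * ∑ (b ∘ suc) n) + ∑ ((a ∘ suc) ⋆ b) n
      ≈⟨ +-congʳ (distribˡ (a 0) _ _) ⟨
    a 0 * ∑ b (suc n) + ∑ ((a ∘ suc) ⋆ b) n ∎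

  -- The error is Σᵢ aᵢ (x − Σ_{j<n−i} bⱼ).  The offset p lets the
  -- induction pass to the shifted sequence.
  product-error : ∀ b x A K N → 0# < A → 0# < K →
    (∀ j → j ℕ.≤ N → Bdd (x - ∑ b j) (K * g j)) →
    ∀ n a p → n ℕ.≤ N → (∀ i → Bdd (a i) (A * g (p ℕ.+ i))) →
    Bdd (∑ a n * x - ∑ (a ⋆ b) n) (fromℕ (suc n) * (A * K) * g (p ℕ.+ n))
  -- The error is 0 here, but `Bdd` is strict and needs a positive bound. This is why the factor is
  -- n + 1 and not n.
  product-error b x A K N 0<A 0<K tail zero a p n≤N a< =
    <-respˡ-≈ (solve 1 (λ x → con 0ℤ := con 0ℤ :* x :- con 0ℤ) refl x) pos ,
    <-respˡ-≈ (solve 1 (λ x → con 0ℤ := :- (con 0ℤ :* x :- con 0ℤ)) refl x) pos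
    where
    pos : 0# < fromℕ 1 * (A * K) * g (p ℕ.+ 0)
    pos = *-pos (*-pos (fromℕ-pos 1) (*-pos 0<A 0<K)) (g-pos (p ℕ.+ 0))
  product-error b x A K N 0<A 0<K tail (suc n) a p n<N a< = Bdd-resp eq₁ eq₂
    -- The row of a₀ costs A 2⁻ᵖ · K 2⁻⁽ⁿ⁺¹⁾. Shifting a raises p by one while n drops by one, so p
    -- + n is preserved and each row adds the same amount.
    (Bdd-+ (Bdd-* (a< 0) (tail (suc n) n<N))
           (product-error b x A K N 0<A 0<K tail n (a ∘ suc) (suc p) (ℕ.<⇒≤ n<N)
             (λ i → ≡.subst (λ k → Bdd (a (suc i)) (A * g k)) (ℕ.+-suc p i) (a< (suc i)))))
    where
    eq₁ : a 0 * (x - ∑ b (suc n)) + (∑ (a ∘ suc) n * x - ∑ ((a ∘ suc) ⋆ b) n) ≈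
          ∑ a (suc n) * x - ∑ (a ⋆ b) (suc n)
    eq₁ = begin
      a 0 * (x - ∑ b (suc n)) + (∑ (a ∘ suc) n * x - ∑ ((a ∘ suc) ⋆ b) n)
        ≈⟨ solve 5 (λ a x s t u → a :* (x :- s) :+ (t :* x :- u) := (a :+ t) :* x :- (a :* s :+ u)) refl
             (a 0) x (∑ b (suc n)) (∑ (a ∘ suc) n) (∑ ((a ∘ suc) ⋆ b) n) ⟩
      (a 0 + ∑ (a ∘ suc) n) * x - (a 0 * ∑ b (suc n) + ∑ ((a ∘ suc) ⋆ b) n)
        ≈⟨ +-congˡ (-‿cong (∑-⋆-suc a b n)) ⟨
      ∑ a (suc n) * x - ∑ (a ⋆ b) (suc n) ∎
    eq₂ : A * g (p ℕ.+ 0) * (K * g (suc n)) + fromℕ (suc n) * (A * K) * g (suc p ℕ.+ n) ≈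
          fromℕ (suc (suc n)) * (A * K) * g (p ℕ.+ suc n)
    eq₂ = begin
      A * g (p ℕ.+ 0) * (K * g (suc n)) + fromℕ (suc n) * (A * K) * g (suc p ℕ.+ n)
        ≈⟨ +-congʳ (solve 4 (λ a b c d → a :* b :* (c :* d) := a :* c :* (b :* d)) refl A _ K _) ⟩
      A * K * (g (p ℕ.+ 0) * g (suc n)) + fromℕ (suc n) * (A * K) * g (suc p ℕ.+ n)
        ≡⟨ ≡.cong₂ (λ i j → A * K * (g i * g (suc n)) + fromℕ (suc n) * (A * K) * g j)
             (ℕ.+-identityʳ p) (≡.sym (ℕ.+-suc p n)) ⟩
      A * K * (g p * g (suc n)) + fromℕ (suc n) * (A * K) * g (p ℕ.+ suc n)
        ≈⟨ +-congʳ (*-congˡ (g-+ p (suc n))) ⟨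
      A * K * g (p ℕ.+ suc n) + fromℕ (suc n) * (A * K) * g (p ℕ.+ suc n)
        ≈⟨ +-congʳ (*-congʳ (*-identityˡ (A * K))) ⟨
      1# * (A * K) * g (p ℕ.+ suc n) + fromℕ (suc n) * (A * K) * g (p ℕ.+ suc n)
        ≈⟨ solve 4 (λ e s k g → e :* k :* g :+ s :* k :* g := (e :+ s) :* k :* g) refl
             1# (fromℕ (suc n)) (A * K) (g (p ℕ.+ suc n)) ⟩
      fromℕ (suc (suc n)) * (A * K) * g (p ℕ.+ suc n) ∎

  -- `tail-upper` is one-sided, so it is applied to t and to -t; the 3 counts the copies of D 2⁻ᵐ in
  -- its slack.
  tail-bound : ∀ {t : ℕ → Carrier} {D} → 0# < D → (∀ k → Bdd (t k) (D * g k)) →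
               ∀ m n → m ℕ.≤ n → Bdd (∑ t n - ∑ t m) (fromℕ 3 * D * g m)
  tail-bound {t} {D} 0<D t< m n m≤n = Bdd-resp
    (+-cong (partialSum≈∑ t n) (-‿cong (partialSum≈∑ t m))) refl
    (shift (tail-upper t D 0<D (proj₁ ∘ t<) m n m≤n) ,
     <-respˡ-≈ eq (shift (tail-upper (λ k → - t k) D 0<D (proj₂ ∘ t<) m n m≤n)))
    where
    shift : ∀ {u v} → u < v + (D * g m + D * g m + D * g m) → u - v < fromℕ 3 * D * g m
    shift {u} {v} u< = <-respʳ-≈
      (solve 3 (λ v D g → (v :+ (D :* g :+ D :* g :+ D :* g)) :- v := con (+ 3) :* D :* g)
        refl v D (g m))
      (+-monoˡ-< (- v) u<)
    eq : partialSum (λ k → - t k) n - partialSum (λ k → - t k) m ≈ - (partialSum t n - partialSum t m)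
    eq = trans (+-cong (partialSum-neg t n) (-‿cong (partialSum-neg t m)))
      (solve 2 (λ a b → (:- a) :- (:- b) := :- (a :- b)) refl _ _)

  Bdd-trans : ∀ {x y z} → Bdd x y → y < z → Bdd x z
  Bdd-trans (p , q) y<z = <-trans p y<z , <-trans q y<z

  cauchy-product : ∀ {a b} → Geometric a → Geometric b → ∀ {l m} →
    partialSum a ⟶ l → partialSum b ⟶ m → partialSum (a ⋆ b) ⟶ (l * m)
  cauchy-product {a} {b} (A , a<) (B , b<) {l} {m} a⟶l b⟶m = Null⇒⟶ {partialSum (a ⋆ b)} {l * m}
    (Null-cong {λ n → - error n + (partialSum a n * partialSum b n - l * m)} eq
      (Null-+ {λ n → - error n} (Null-neg {error} errors)
        (⟶⇒Null {λ n → partialSum a n * partialSum b n} {l * m}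
          (⟶-* {partialSum a} {partialSum b} {l} {m} a⟶l b⟶m))))
    where
    0<A : 0# < fromℕ A
    0<A = Bdd⇒pos (a< 0)
    0<B : 0# < fromℕ B
    0<B = Bdd⇒pos (b< 0)
    K = fromℕ 3 * fromℕ B
    0<K : 0# < K
    0<K = *-pos (fromℕ-pos 3) 0<B
    error : ℕ → Carrier
    error n = ∑ a n * ∑ b n - ∑ (a ⋆ b) n
    errors : Null error
    error-bound : ∀ n → Bdd (error n) (fromℕ (suc n) * (fromℕ A * K) * g n)
    -- Here x is the finite sum `∑ b n` and not the limit of the series, so the required tails are
    -- differences of partial sums.
    error-bound n = product-error b (∑ b n) (fromℕ A) K n 0<A 0<K
      (λ j j≤n → tail-bound {b} {fromℕ B} 0<B (unscale {b} {fromℕ B} b<) j n j≤n) n a 0 ℕ.≤-refl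
      (unscale {a} {fromℕ A} a<)
    errors ε 0<ε = let (N , small) = n*g-null (fromℕ A * K) (*-pos 0<A 0<K) ε 0<ε in N , λ n N≤n →
      Bdd-trans (error-bound n) (proj₁ (small n N≤n))
    eq : ∀ n → - (∑ a n * ∑ b n - ∑ (a ⋆ b) n) + (partialSum a n * partialSum b n - l * m) ≈
               partialSum (a ⋆ b) n - l * m
    eq n = begin
      - (∑ a n * ∑ b n - ∑ (a ⋆ b) n) + (partialSum a n * partialSum b n - l * m)
        ≈⟨ +-congˡ (+-congʳ (*-cong (partialSum≈∑ a n) (partialSum≈∑ b n))) ⟩
      - (∑ a n * ∑ b n - ∑ (a ⋆ b) n) + (∑ a n * ∑ b n - l * m)
        ≈⟨ solve 3 (λ x y z → :- (x :- y) :+ (x :- z) := y :- z) refl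
             (∑ a n * ∑ b n) (∑ (a ⋆ b) n) (l * m) ⟩
      ∑ (a ⋆ b) n - l * m
        ≈⟨ +-congʳ (partialSum≈∑ (a ⋆ b) n) ⟨
      partialSum (a ⋆ b) n - l * m ∎

-- Complex numbers and the exponential

nCk*[k!*[n∸k]!]≡n! : ∀ {n k} → k ℕ.≤ n → (n C k) ℕ.* (k ! ℕ.* (n ℕ.∸ k) !) ≡ n !
nCk*[k!*[n∸k]!]≡n! {n} {k} k≤n = ≡.trans
  (≡.cong (ℕ._* (k ! ℕ.* (n ℕ.∸ k) !)) (nCk≡n!/k![n-k]! k≤n))
  (m/n*n≡m {{k ℕ.!* (n ℕ.∸ k) !≢0}} (k![n∸k]!∣n! k≤n))

module Exponential {c ℓ₁ ℓ₂} (ℝ : CompleteOrderedField c ℓ₁ ℓ₂) where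

  open Analysis ℝ
  open Limits ℝ
  open CauchyProduct ℝ
  open CommutativeRing commutativeRing using (semiring; commutativeSemiring)
  open FromInteger commutativeRing using (module Solver)
  open Solver using (solve; con; _:+_; _:*_; _:-_; :-_; _:=_)
  private
    module ℝΣ = SemiringSum semiring
    module ℝ^ = Exp commutativeSemiring
    module ≈-Reasoning = SetoidReasoning (CommutativeRing.setoid commutativeRing)

  ℂ-isCommutativeRing : IsCommutativeRing _≈ℂ_ _+ℂ_ _*ℂ_
    (λ z → (- re z) +i (- im z)) 0ℂ (1# +i 0#)
  ℂ-isCommutativeRing = record
    { isRing = record
      { +-isAbelianGroup = record
        { isGroup = record
          { isMonoid = record
            { isSemigroup = record
              { isMagma = record
                { isEquivalence = record
                  { refl  = refl , refl
                  ; sym   = λ (p , q) → sym p , sym q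
                  ; trans = λ (p , q) (p′ , q′) → trans p p′ , trans q q′
                  }
                ; ∙-cong = λ (p , q) (p′ , q′) → +-cong p p′ , +-cong q q′
                }
              ; assoc = λ _ _ _ → +-assoc _ _ _ , +-assoc _ _ _
              }
            ; identity = (λ _ → +-identityˡ _ , +-identityˡ _) , (λ _ → +-identityʳ _ , +-identityʳ _)
            }
          ; inverse = (λ _ → -‿inverseˡ _ , -‿inverseˡ _) , (λ _ → -‿inverseʳ _ , -‿inverseʳ _)
          ; ⁻¹-cong = λ (p , q) → -‿cong p , -‿cong q
          }
        ; comm = λ _ _ → +-comm _ _ , +-comm _ _
        }
      ; *-cong = λ (p , q) (p′ , q′) →
          +-cong (*-cong p p′) (-‿cong (*-cong q q′)) , +-cong (*-cong p q′) (*-cong q p′)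
      ; *-assoc = λ z w v →
          solve 6 (λ a b c d e f → (a :* c :- b :* d) :* e :- (a :* d :+ b :* c) :* f
                                := a :* (c :* e :- d :* f) :- b :* (c :* f :+ d :* e)) refl
            (re z) (im z) (re w) (im w) (re v) (im v) ,
          solve 6 (λ a b c d e f → (a :* c :- b :* d) :* f :+ (a :* d :+ b :* c) :* e
                                := a :* (c :* f :+ d :* e) :+ b :* (c :* e :- d :* f)) refl
            (re z) (im z) (re w) (im w) (re v) (im v)
      ; *-identity = identityˡ , λ z → let (p , q) = identityˡ z ; (p′ , q′) = comm z _ in
          trans p′ p , trans q′ q
      ; distrib =
          (λ z w v →
            solve 6 (λ a b c d e f → a :* (c :+ e) :- b :* (d :+ f)
                                  := (a :* c :- b :* d) :+ (a :* e :- b :* f)) refl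
              (re z) (im z) (re w) (im w) (re v) (im v) ,
            solve 6 (λ a b c d e f → a :* (d :+ f) :+ b :* (c :+ e)
                                  := (a :* d :+ b :* c) :+ (a :* f :+ b :* e)) refl
              (re z) (im z) (re w) (im w) (re v) (im v)) ,
          (λ z w v →
            solve 6 (λ a b c d e f → (c :+ e) :* a :- (d :+ f) :* b
                                  := (c :* a :- d :* b) :+ (e :* a :- f :* b)) refl
              (re z) (im z) (re w) (im w) (re v) (im v) ,
            solve 6 (λ a b c d e f → (c :+ e) :* b :+ (d :+ f) :* a
                                  := (c :* b :+ d :* a) :+ (e :* b :+ f :* a)) refl
              (re z) (im z) (re w) (im w) (re v) (im v))
      }
    ; *-comm = comm
    }
    where
    comm : ∀ z w → z *ℂ w ≈ℂ w *ℂ z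
    comm z w =
      solve 4 (λ a b c d → a :* c :- b :* d := c :* a :- d :* b) refl (re z) (im z) (re w) (im w) ,
      solve 4 (λ a b c d → a :* d :+ b :* c := c :* b :+ d :* a) refl (re z) (im z) (re w) (im w)
    identityˡ : ∀ z → (1# +i 0#) *ℂ z ≈ℂ z
    identityˡ z =
      trans (+-congʳ (*-identityˡ (re z))) (solve 2 (λ a b → a :- con 0ℤ :* b := a) refl (re z) (im z)) ,
      trans (+-congʳ (*-identityˡ (im z))) (solve 2 (λ a b → b :+ con 0ℤ :* a := b) refl (re z) (im z))

  ℂ-commutativeRing : CommutativeRing c ℓ₁
  ℂ-commutativeRing = record { isCommutativeRing = ℂ-isCommutativeRing }

  module ℂR = CommutativeRing ℂ-commutativeRing
  module ℂΣ = SemiringSum ℂR.semiring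
  module ℂ^ = Exp ℂR.commutativeSemiring
  open SemiringMult ℂR.semiring using () renaming (_×_ to _×ℂ_)
  open CommutativeSemigroupProperties (CommutativeMonoid.commutativeSemigroup ℂR.*-commutativeMonoid)
    using (interchange)
  open SetoidReasoning ℂR.setoid

  ι-cong : ∀ {x y} → x ≈ y → ι x ≈ℂ ι y
  ι-cong p = p , refl

  ι-+ : ∀ x y → ι (x + y) ≈ℂ ι x +ℂ ι y
  ι-+ x y = refl , sym (+-identityˡ 0#)

  ι-* : ∀ x y → ι (x * y) ≈ℂ ι x *ℂ ι y
  ι-* x y = solve 2 (λ x y → x :* y := x :* y :- con 0ℤ :* con 0ℤ) refl x y ,
            solve 2 (λ x y → con 0ℤ := x :* con 0ℤ :+ con 0ℤ :* y) refl x y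

  ι-^ : ∀ x n → ι (x ℝ^.^ n) ≈ℂ ι x ^ℂ n
  ι-^ x zero    = ℂR.refl
  ι-^ x (suc n) = ℂR.trans (ι-* x _) (ℂR.*-congˡ (ι-^ x n))

  ι-scale : ∀ x z → ι x *ℂ z ≈ℂ ((x * re z) +i (x * im z))
  ι-scale x z = solve 3 (λ x a b → x :* a :- con 0ℤ :* b := x :* a) refl x (re z) (im z) ,
                solve 3 (λ x a b → x :* b :+ con 0ℤ :* a := x :* b) refl x (re z) (im z)

  -- The binomial theorem states its coefficients as repeated addition; as real scalars they can be
  -- combined with the inverse factorials.
  ×ℂ≈ι* : ∀ n z → n ×ℂ z ≈ℂ ι (fromℕ n) *ℂ z
  ×ℂ≈ι* zero    z = ℂR.sym (ℂR.zeroˡ z)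
  ×ℂ≈ι* (suc n) z = begin
    z +ℂ n ×ℂ z                           ≈⟨ ℂR.+-cong (ℂR.sym (ℂR.*-identityˡ z)) (×ℂ≈ι* n z) ⟩
    ℂR.1# *ℂ z +ℂ ι (fromℕ n) *ℂ z        ≈⟨ ℂR.distribʳ z _ _ ⟨
    (ℂR.1# +ℂ ι (fromℕ n)) *ℂ z           ≈⟨ ℂR.*-congʳ (ι-+ 1# (fromℕ n)) ⟨
    ι (fromℕ (suc n)) *ℂ z                ∎

  1/! : ℕ → Carrier
  1/! k = (1/ (k !)) {{k ℕ.!≢0}}

  1/!-C : ∀ {n k} → k ℕ.≤ n → 1/! n * fromℕ (n C k) ≈ 1/! k * 1/! (n ℕ.∸ k)
  1/!-C {n} {k} k≤n = ≈-Reasoning.begin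
    1/! n * b
      ≈-Reasoning.≈⟨ trans (*-identityʳ _) (*-identityʳ _) ⟨
    1/! n * b * 1# * 1#
      ≈-Reasoning.≈⟨ *-cong (*-congˡ (m*1/m (k !) {{k ℕ.!≢0}}))
                     (m*1/m ((n ℕ.∸ k) !) {{(n ℕ.∸ k) ℕ.!≢0}}) ⟨
    1/! n * b * (p * 1/! k) * (q * 1/! (n ℕ.∸ k))
      ≈-Reasoning.≈⟨ solve 6 (λ u b p v q w → u :* b :* (p :* v) :* (q :* w)
           := (b :* (p :* q) :* u) :* (v :* w)) refl
           (1/! n) b p (1/! k) q (1/! (n ℕ.∸ k)) ⟩
    (b * (p * q) * 1/! n) * (1/! k * 1/! (n ℕ.∸ k))
      ≈-Reasoning.≈⟨ *-congʳ (*-congʳ (trans (*-congˡ (sym (fromℕ-* (k !) _)))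
                                         (sym (fromℕ-* (n C k) _)))) ⟩
    (fromℕ ((n C k) ℕ.* (k ! ℕ.* (n ℕ.∸ k) !)) * 1/! n) * (1/! k * 1/! (n ℕ.∸ k))
      ≈-Reasoning.≡⟨ ≡.cong (λ z → fromℕ z * 1/! n * (1/! k * 1/! (n ℕ.∸ k))) (nCk*[k!*[n∸k]!]≡n! k≤n) ⟩
    (fromℕ (n !) * 1/! n) * (1/! k * 1/! (n ℕ.∸ k))
      ≈-Reasoning.≈⟨ trans (*-congʳ (m*1/m (n !) {{n ℕ.!≢0}})) (*-identityˡ _) ⟩
    1/! k * 1/! (n ℕ.∸ k) ≈-Reasoning.∎
    where
    b = fromℕ (n C k)
    p = fromℕ (k !)
    q = fromℕ ((n ℕ.∸ k) !)

  expTerm≈ : ∀ z k → expTerm z k ≈ℂ ι (1/! k) *ℂ z ^ℂ k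
  expTerm≈ z k = ℂR.sym (ι-scale (1/! k) (z ^ℂ k))

  -- This is the binomial theorem divided by k!: the coefficient C(k, i)/k! splits as 1/i! · 1/(k -
  -- i)!, which makes the right side a convolution.
  expTerm-+ : ∀ z w k → expTerm (z +ℂ w) k ≈ℂ
              sumℂ {suc k} (λ i → expTerm z (toℕ i) *ℂ expTerm w (k ℕ.∸ toℕ i))
  expTerm-+ z w k = begin
    expTerm (z +ℂ w) k
      ≈⟨ expTerm≈ (z +ℂ w) k ⟩
    ι (1/! k) *ℂ (z +ℂ w) ^ℂ k
      ≈⟨ ℂR.*-congˡ (Binomial.theorem ℂR.commutativeSemiring k z w) ⟩
    ι (1/! k) *ℂ sumℂ {suc k} (λ i → (k C toℕ i) ×ℂ (z ^ℂ toℕ i *ℂ w ^ℂ (k ℕ.∸ toℕ i)))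
      ≈⟨ ℂΣ.*-distribˡ-sum {suc k} (ι (1/! k))
           (λ i → (k C toℕ i) ×ℂ (z ^ℂ toℕ i *ℂ w ^ℂ (k ℕ.∸ toℕ i))) ⟩
    sumℂ {suc k} (λ i → ι (1/! k) *ℂ ((k C toℕ i) ×ℂ (z ^ℂ toℕ i *ℂ w ^ℂ (k ℕ.∸ toℕ i))))
      ≈⟨ ℂΣ.sum-cong-≋ {suc k} (λ i → term (toℕ i) (ℕ.≤-pred (Fin.toℕ<n i))) ⟩
    sumℂ {suc k} (λ i → expTerm z (toℕ i) *ℂ expTerm w (k ℕ.∸ toℕ i)) ∎
    where
    term : ∀ i → i ℕ.≤ k → ι (1/! k) *ℂ ((k C i) ×ℂ (z ^ℂ i *ℂ w ^ℂ (k ℕ.∸ i))) ≈ℂ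
                           expTerm z i *ℂ expTerm w (k ℕ.∸ i)
    term i i≤k = begin
      ι (1/! k) *ℂ ((k C i) ×ℂ v)                    ≈⟨ ℂR.*-congˡ (×ℂ≈ι* (k C i) v) ⟩
      ι (1/! k) *ℂ (ι (fromℕ (k C i)) *ℂ v)          ≈⟨ ℂR.*-assoc (ι (1/! k)) (ι (fromℕ (k C i))) v ⟨
      (ι (1/! k) *ℂ ι (fromℕ (k C i))) *ℂ v          ≈⟨ ℂR.*-congʳ (ι-* (1/! k) (fromℕ (k C i))) ⟨
      ι (1/! k * fromℕ (k C i)) *ℂ v                 ≈⟨ ℂR.*-congʳ (ι-cong (1/!-C i≤k)) ⟩
      ι (1/! i * 1/! (k ℕ.∸ i)) *ℂ v                ≈⟨ ℂR.*-congʳ (ι-* (1/! i) (1/! (k ℕ.∸ i))) ⟩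
      (ι (1/! i) *ℂ ι (1/! (k ℕ.∸ i))) *ℂ v
        ≈⟨ interchange (ι (1/! i)) (ι (1/! (k ℕ.∸ i))) (z ^ℂ i) (w ^ℂ (k ℕ.∸ i)) ⟩
      (ι (1/! i) *ℂ z ^ℂ i) *ℂ (ι (1/! (k ℕ.∸ i)) *ℂ w ^ℂ (k ℕ.∸ i))
        ≈⟨ ℂR.*-cong (expTerm≈ z i) (expTerm≈ w (k ℕ.∸ i)) ⟨
      expTerm z i *ℂ expTerm w (k ℕ.∸ i) ∎
      where v = z ^ℂ i *ℂ w ^ℂ (k ℕ.∸ i)

  re-expTerm im-expTerm : ℂ → ℕ → Carrier
  re-expTerm z k = re (expTerm z k)
  im-expTerm z k = im (expTerm z k)

  exp-limit : ∀ z → (partialSum (re-expTerm z) ⟶ re (exp z)) × (partialSum (im-expTerm z) ⟶ im (exp z))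
  exp-limit z = series-limit (re-expTerm z) (proj₁ (expTerm-geometric z)) ,
                series-limit (im-expTerm z) (proj₂ (expTerm-geometric z))

  partialSum-cong : ∀ {s t : ℕ → Carrier} → (∀ k → s k ≈ t k) → ∀ n → partialSum s n ≈ partialSum t n
  partialSum-cong s≈t zero    = refl
  partialSum-cong s≈t (suc n) = +-cong (partialSum-cong s≈t n) (s≈t n)

  partialSum-+ : ∀ (s t : ℕ → Carrier) n →
                 partialSum (λ k → s k + t k) n ≈ partialSum s n + partialSum t n
  partialSum-+ s t zero    = sym (+-identityˡ 0#)
  partialSum-+ s t (suc n) = trans (+-congʳ (partialSum-+ s t n))
    (solve 4 (λ a b c d → (a :+ b) :+ (c :+ d) := (a :+ c) :+ (b :+ d)) refl _ _ (s n) (t n))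

  -- The value of `exp` is known only as a limit, so an identity for it is proved by exhibiting a
  -- second limit of the same partial sums.
  exp-unique : ∀ z {l m} → partialSum (re-expTerm z) ⟶ l → partialSum (im-expTerm z) ⟶ m →
               exp z ≈ℂ (l +i m)
  exp-unique z s⟶l s⟶m = ⟶-unique {partialSum (re-expTerm z)} (proj₁ (exp-limit z)) s⟶l ,
                         ⟶-unique {partialSum (im-expTerm z)} (proj₂ (exp-limit z)) s⟶m

  ^ℂ-cong : ∀ {z w} k → z ≈ℂ w → z ^ℂ k ≈ℂ w ^ℂ k
  ^ℂ-cong k = ℂ^.^-congˡ k

  -- `complete` is not assumed to respect ≈, so congruence also goes through uniqueness of limits.
  exp-cong : ∀ {z w} → z ≈ℂ w → exp z ≈ℂ exp w
  exp-cong {z} {w} z≈w = exp-unique z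
    (⟶-cong {partialSum (re-expTerm w)} (partialSum-cong {re-expTerm w} {re-expTerm z}
      (λ k → *-congˡ (sym (proj₁ (^ℂ-cong k z≈w))))) (proj₁ (exp-limit w)))
    (⟶-cong {partialSum (im-expTerm w)} (partialSum-cong {im-expTerm w} {im-expTerm z}
      (λ k → *-congˡ (sym (proj₂ (^ℂ-cong k z≈w))))) (proj₂ (exp-limit w)))

  re-sum : ∀ {n} (v : Fin n → ℂ) → re (sumℂ v) ≡ ℝΣ.sum (λ i → re (v i))
  re-sum {zero}  v = ≡.refl
  re-sum {suc n} v = ≡.cong (λ x → re (v Fin.zero) + x) (re-sum (λ i → v (Fin.suc i)))

  im-sum : ∀ {n} (v : Fin n → ℂ) → im (sumℂ v) ≡ ℝΣ.sum (λ i → im (v i))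
  im-sum {zero}  v = ≡.refl
  im-sum {suc n} v = ≡.cong (λ x → im (v Fin.zero) + x) (im-sum (λ i → v (Fin.suc i)))

  sum-neg : ∀ {n} (v : Fin n → Carrier) → ℝΣ.sum (λ i → - v i) ≈ - ℝΣ.sum v
  sum-neg {zero}  v = solve 0 (con 0ℤ := :- con 0ℤ) refl
  sum-neg {suc n} v = trans (+-congˡ (sum-neg (λ i → v (Fin.suc i))))
    (solve 2 (λ a b → (:- a) :+ (:- b) := :- (a :+ b)) refl _ _)

  module _ (z w : ℂ) where
    private
      a = re-expTerm z
      b = im-expTerm z
      a′ = re-expTerm w
      b′ = im-expTerm w

    re-expTerm-+ : ∀ k → re-expTerm (z +ℂ w) k ≈ (a ⋆ a′) k + - (b ⋆ b′) k
    re-expTerm-+ k = ≈-Reasoning.begin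
      re-expTerm (z +ℂ w) k
        ≈-Reasoning.≈⟨ proj₁ (expTerm-+ z w k) ⟩
      re (sumℂ {suc k} (λ i → expTerm z (toℕ i) *ℂ expTerm w (k ℕ.∸ toℕ i)))
        ≈-Reasoning.≡⟨ re-sum {suc k} (λ i → expTerm z (toℕ i) *ℂ expTerm w (k ℕ.∸ toℕ i)) ⟩
      ℝΣ.sum {suc k} (λ i → u i + - v i)
        ≈-Reasoning.≈⟨ ℝΣ.∑-distrib-+ {suc k} u (λ i → - v i) ⟩
      (a ⋆ a′) k + ℝΣ.sum {suc k} (λ i → - v i)
        ≈-Reasoning.≈⟨ +-congˡ (sum-neg {suc k} v) ⟩
      (a ⋆ a′) k + - (b ⋆ b′) k ≈-Reasoning.∎
      where
      u v : Fin (suc k) → Carrier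
      u i = a (toℕ i) * a′ (k ℕ.∸ toℕ i)
      v i = b (toℕ i) * b′ (k ℕ.∸ toℕ i)

    im-expTerm-+ : ∀ k → im-expTerm (z +ℂ w) k ≈ (a ⋆ b′) k + (b ⋆ a′) k
    im-expTerm-+ k = ≈-Reasoning.begin
      im-expTerm (z +ℂ w) k
        ≈-Reasoning.≈⟨ proj₂ (expTerm-+ z w k) ⟩
      im (sumℂ {suc k} (λ i → expTerm z (toℕ i) *ℂ expTerm w (k ℕ.∸ toℕ i)))
        ≈-Reasoning.≡⟨ im-sum {suc k} (λ i → expTerm z (toℕ i) *ℂ expTerm w (k ℕ.∸ toℕ i)) ⟩
      ℝΣ.sum {suc k} (λ i → u i + v i)
        ≈-Reasoning.≈⟨ ℝΣ.∑-distrib-+ {suc k} u v ⟩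
      (a ⋆ b′) k + (b ⋆ a′) k ≈-Reasoning.∎
      where
      u v : Fin (suc k) → Carrier
      u i = a (toℕ i) * b′ (k ℕ.∸ toℕ i)
      v i = b (toℕ i) * a′ (k ℕ.∸ toℕ i)

    -- Complex multiplication combines four real products, so four real Cauchy products, one
    -- subtracted, yield both coordinates without a theory of complex limits.
    exp-+ : exp (z +ℂ w) ≈ℂ exp z *ℂ exp w
    exp-+ = exp-unique (z +ℂ w)
      (⟶-cong {λ n → partialSum (a ⋆ a′) n + - partialSum (b ⋆ b′) n} eq₁
        (⟶-+ {partialSum (a ⋆ a′)} {λ n → - partialSum (b ⋆ b′) n}
          (cauchy-product {a} {a′} Ga Ga′ a⟶ a′⟶)
          (⟶-neg {partialSum (b ⋆ b′)} (cauchy-product {b} {b′} Gb Gb′ b⟶ b′⟶))))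
      (⟶-cong {λ n → partialSum (a ⋆ b′) n + partialSum (b ⋆ a′) n} eq₂
        (⟶-+ {partialSum (a ⋆ b′)} {partialSum (b ⋆ a′)}
          (cauchy-product {a} {b′} Ga Gb′ a⟶ b′⟶)
          (cauchy-product {b} {a′} Gb Ga′ b⟶ a′⟶)))
      where
      Ga = proj₁ (expTerm-geometric z)
      Gb = proj₂ (expTerm-geometric z)
      Ga′ = proj₁ (expTerm-geometric w)
      Gb′ = proj₂ (expTerm-geometric w)
      a⟶ = proj₁ (exp-limit z)
      b⟶ = proj₂ (exp-limit z)
      a′⟶ = proj₁ (exp-limit w)
      b′⟶ = proj₂ (exp-limit w)
      eq₁ : ∀ n → partialSum (a ⋆ a′) n + - partialSum (b ⋆ b′) n ≈ partialSum (re-expTerm (z +ℂ w)) n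
      eq₁ n = ≈-Reasoning.begin
        partialSum (a ⋆ a′) n + - partialSum (b ⋆ b′) n
          ≈-Reasoning.≈⟨ +-congˡ (partialSum-neg (b ⋆ b′) n) ⟨
        partialSum (a ⋆ a′) n + partialSum (λ k → - (b ⋆ b′) k) n
          ≈-Reasoning.≈⟨ partialSum-+ (a ⋆ a′) (λ k → - (b ⋆ b′) k) n ⟨
        partialSum (λ k → (a ⋆ a′) k + - (b ⋆ b′) k) n
          ≈-Reasoning.≈⟨ partialSum-cong {re-expTerm (z +ℂ w)} re-expTerm-+ n ⟨
        partialSum (re-expTerm (z +ℂ w)) n ≈-Reasoning.∎
      eq₂ : ∀ n → partialSum (a ⋆ b′) n + partialSum (b ⋆ a′) n ≈ partialSum (im-expTerm (z +ℂ w)) n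
      eq₂ n = trans (sym (partialSum-+ (a ⋆ b′) (b ⋆ a′) n))
                    (sym (partialSum-cong {im-expTerm (z +ℂ w)} im-expTerm-+ n))

-- The unit circle

module Circle {c ℓ₁ ℓ₂} (ℝ : CompleteOrderedField c ℓ₁ ℓ₂) where

  open Analysis ℝ
  open Limits ℝ
  open CauchyProduct ℝ
  open Exponential ℝ
  open CommutativeRing commutativeRing using (commutativeSemiring)
  open FromInteger commutativeRing using (module Solver; fromℤ-+; fromℤ-neg; fromℤ-*)
  open Solver using (solve; con; _:+_; _:*_; _:-_; :-_; _:=_)
  private
    module ℝ^ = Exp commutativeSemiring
    module ≈-Reasoning = SetoidReasoning (CommutativeRing.setoid commutativeRing)
  open SetoidReasoning ℂR.setoid

  conj : ℂ → ℂ
  conj z = re z +i (- im z)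

  conj-cong : ∀ {z w} → z ≈ℂ w → conj z ≈ℂ conj w
  conj-cong (p , q) = p , -‿cong q

  conj-* : ∀ z w → conj (z *ℂ w) ≈ℂ conj z *ℂ conj w
  conj-* z w =
    solve 4 (λ a b c d → a :* c :- b :* d := a :* c :- (:- b) :* (:- d)) refl
      (re z) (im z) (re w) (im w) ,
    solve 4 (λ a b c d → :- (a :* d :+ b :* c) := a :* (:- d) :+ (:- b) :* c) refl
      (re z) (im z) (re w) (im w)

  conj-^ : ∀ z k → conj (z ^ℂ k) ≈ℂ conj z ^ℂ k
  conj-^ z zero    = refl , solve 0 (:- con 0ℤ := con 0ℤ) refl
  conj-^ z (suc k) = ℂR.trans (conj-* z (z ^ℂ k)) (ℂR.*-congˡ (conj-^ z k))

  -- Conjugation is multiplicative and fixes the real factors 1/k!, so it acts on the series term by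
  -- term.
  exp-conj : ∀ z → exp (conj z) ≈ℂ conj (exp z)
  exp-conj z = exp-unique (conj z)
    (⟶-cong {partialSum (re-expTerm z)} (partialSum-cong {re-expTerm z} {re-expTerm (conj z)}
      (λ k → *-congˡ (proj₁ (conj-^ z k)))) (proj₁ (exp-limit z)))
    (⟶-cong {λ n → - partialSum (im-expTerm z) n} eq
      (⟶-neg {partialSum (im-expTerm z)} (proj₂ (exp-limit z))))
    where
    term : ∀ k → - im-expTerm z k ≈ im-expTerm (conj z) k
    term k = trans (solve 2 (λ x y → :- (x :* y) := x :* (:- y)) refl (1/! k) (im (z ^ℂ k)))
                   (*-congˡ (proj₂ (conj-^ z k)))
    eq : ∀ n → - partialSum (im-expTerm z) n ≈ partialSum (im-expTerm (conj z)) n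
    eq n = trans (sym (partialSum-neg (im-expTerm z) n)) (partialSum-cong term n)

  cis : Carrier → ℂ
  cis θ = exp (0# +i θ)

  cis-cong : ∀ {θ φ} → θ ≈ φ → cis θ ≈ℂ cis φ
  cis-cong {θ} {φ} θ≈φ = exp-cong {0# +i θ} {0# +i φ} (refl , θ≈φ)

  cis-+ : ∀ θ φ → cis (θ + φ) ≈ℂ cis θ *ℂ cis φ
  cis-+ θ φ = ℂR.trans (exp-cong {0# +i (θ + φ)} {(0# +i θ) +ℂ (0# +i φ)} (sym (+-identityˡ 0#) , refl))
                       (exp-+ (0# +i θ) (0# +i φ))

  -- `0# +i (- θ)` is by definition the conjugate of `0# +i θ`.
  cis-neg : ∀ θ → cis (- θ) ≈ℂ conj (cis θ)
  cis-neg θ = exp-conj (0# +i θ)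

  -- The empty partial sum is 0, so a series whose terms vanish after the first is constant only
  -- from index 1 on.
  constant-limit : ∀ {s : ℕ → Carrier} {l} → (∀ n → s (suc n) ≈ l) → s ⟶ l
  constant-limit {s} {l} s≈l ε 0<ε = 1 , λ where
    (suc n) _ → <-respˡ-≈ (sym (trans (+-congʳ (s≈l n)) (-‿inverseʳ l))) 0<ε ,
                <-respˡ-≈ (sym (trans (+-congˡ (-‿cong (s≈l n))) (-‿inverseʳ l))) 0<ε

  partialSum-zero : ∀ {t : ℕ → Carrier} → (∀ k → t k ≈ 0#) → ∀ n → partialSum t n ≈ 0#
  partialSum-zero t≈0 zero    = refl
  partialSum-zero t≈0 (suc n) = trans (+-cong (partialSum-zero t≈0 n) (t≈0 n)) (+-identityˡ 0#)

  head-limit : ∀ {t : ℕ → Carrier} → (∀ k → t (suc k) ≈ 0#) → partialSum t ⟶ t 0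
  head-limit {t} t≈0 = constant-limit {partialSum t} λ n →
    trans (partialSum-suc t n) (trans (+-congˡ (partialSum-zero {t ∘ suc} t≈0 n)) (+-identityʳ (t 0)))

  exp-0 : exp 0ℂ ≈ℂ ℂR.1#
  exp-0 = ℂR.trans
    (exp-unique 0ℂ {re-expTerm 0ℂ 0} {im-expTerm 0ℂ 0}
      (head-limit {re-expTerm 0ℂ} (λ k → vanish k (proj₁ (0^ k))))
      (head-limit {im-expTerm 0ℂ} (λ k → vanish k (proj₂ (0^ k)))))
    (1/1 , trans (*-comm _ _) (solve 1 (λ x → con 0ℤ :* x := con 0ℤ) refl (1/! 0)))
    where
    0^ : ∀ k → 0ℂ ^ℂ suc k ≈ℂ 0ℂ
    0^ k = ℂR.zeroˡ (0ℂ ^ℂ k)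
    vanish : ∀ k {x} → x ≈ 0# → 1/! (suc k) * x ≈ 0#
    vanish k x≈0 = trans (*-congˡ x≈0) (solve 1 (λ x → x :* con 0ℤ := con 0ℤ) refl (1/! (suc k)))
    1/1 : 1/! 0 * 1# ≈ 1#
    1/1 = trans (*-comm _ _) (trans (*-congʳ (sym (+-identityʳ 1#))) (m*1/m 1))

  -- Only the even powers of iθ have a real part.
  module _ (θ : Carrier) where
    private
      z = 0# +i θ

    z² : z ^ℂ 2 ≈ℂ ι (- 1# * θ ℝ^.^ 2)
    z² = ℂR.trans (ℂR.*-congˡ (ℂR.*-identityʳ z))
      ( trans (solve 1 (λ x → con 0ℤ :* con 0ℤ :- x :* x := :- (x :* x)) refl θ)
          (trans (-‿cong (trans (*-congˡ (sym (*-identityʳ θ))) (sym (*-identityˡ _))))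
                 (solve 2 (λ e x → :- (e :* x) := (:- e) :* x) refl 1# (θ ℝ^.^ 2)))
      , solve 1 (λ x → con 0ℤ :* x :+ x :* con 0ℤ := con 0ℤ) refl θ)

    even-power : ∀ m → z ^ℂ (2 ℕ.* m) ≈ℂ ι ((- 1#) ℝ^.^ m * θ ℝ^.^ (2 ℕ.* m))
    even-power m = begin
      z ^ℂ (2 ℕ.* m)                              ≈⟨ ℂ^.^-assocʳ z 2 m ⟨
      (z ^ℂ 2) ^ℂ m                               ≈⟨ ^ℂ-cong m z² ⟩
      ι (- 1# * θ ℝ^.^ 2) ^ℂ m                    ≈⟨ ι-^ (- 1# * θ ℝ^.^ 2) m ⟨
      ι ((- 1# * θ ℝ^.^ 2) ℝ^.^ m)                ≈⟨ ι-cong (ℝ^.^-distrib-* (- 1#) (θ ℝ^.^ 2) m) ⟩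
      ι ((- 1#) ℝ^.^ m * (θ ℝ^.^ 2) ℝ^.^ m)       ≈⟨ ι-cong (*-congˡ (ℝ^.^-assocʳ θ 2 m)) ⟩
      ι ((- 1#) ℝ^.^ m * θ ℝ^.^ (2 ℕ.* m))        ∎

    odd-power : ∀ m → re (z ^ℂ suc (2 ℕ.* m)) ≈ 0#
    odd-power m = trans (+-congˡ (-‿cong (*-congˡ (proj₂ (even-power m)))))
      (solve 2 (λ x y → con 0ℤ :* x :- y :* con 0ℤ := con 0ℤ) refl (re (z ^ℂ (2 ℕ.* m))) θ)

    even-partialSum : ∀ m → partialSum (re-expTerm z) (2 ℕ.* m) ≈ partialSum (cosTerm θ) m
    even-partialSum zero    = refl
    even-partialSum (suc m) = ≈-Reasoning.begin
      partialSum (re-expTerm z) (2 ℕ.* suc m)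
        ≈-Reasoning.≡⟨ ≡.cong (partialSum (re-expTerm z)) (ℕ.*-suc 2 m) ⟩
      (partialSum (re-expTerm z) (2 ℕ.* m) + re-expTerm z (2 ℕ.* m)) + re-expTerm z (suc (2 ℕ.* m))
        ≈-Reasoning.≈⟨ +-cong (+-cong (even-partialSum m) (*-congˡ (proj₁ (even-power m))))
                             (*-congˡ (odd-power m)) ⟩
      (partialSum (cosTerm θ) m + cosTerm θ m) + 1/! (suc (2 ℕ.* m)) * 0#
        ≈-Reasoning.≈⟨ solve 2 (λ x y → x :+ y :* con 0ℤ := x) refl
              (partialSum (cosTerm θ) m + cosTerm θ m) (1/! (suc (2 ℕ.* m))) ⟩
      partialSum (cosTerm θ) (suc m) ≈-Reasoning.∎

    -- Along even indices the real parts of the exponential sums are the cosine sums, and a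
    -- subsequence keeps the limit.
    re-cis : re (cis θ) ≈ cos θ
    re-cis = ⟶-unique {partialSum (cosTerm θ)}
      (⟶-cong {λ m → partialSum (re-expTerm z) (2 ℕ.* m)} even-partialSum
        (⟶-subsequence {partialSum (re-expTerm z)} {f = 2 ℕ.*_}
          (λ m → ℕ.m≤m+n m (m ℕ.+ 0)) (proj₁ (exp-limit z))))
      (series-limit (cosTerm θ) (cosTerm-geometric θ))

  cis*conj : ∀ θ → cis θ *ℂ conj (cis θ) ≈ℂ ℂR.1#
  cis*conj θ = begin
    cis θ *ℂ conj (cis θ)   ≈⟨ ℂR.*-congˡ (cis-neg θ) ⟨
    cis θ *ℂ cis (- θ)      ≈⟨ cis-+ θ (- θ) ⟨
    cis (θ - θ)             ≈⟨ cis-cong (-‿inverseʳ θ) ⟩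
    cis 0#                  ≈⟨ exp-0 ⟩
    ℂR.1#                   ∎

  2cos : ∀ θ → ι (fromℕ 2 * cos θ) ≈ℂ cis θ +ℂ cis (- θ)
  2cos θ = begin
    ι (fromℕ 2 * cos θ)              ≈⟨ ι-cong (*-congˡ (re-cis θ)) ⟨
    ι (fromℕ 2 * re (cis θ))         ≈⟨ solve 1 (λ a → con (+ 2) :* a := a :+ a) refl (re (cis θ)) ,
                                        sym (-‿inverseʳ (im (cis θ))) ⟩
    cis θ +ℂ conj (cis θ)            ≈⟨ ℂR.+-congˡ (cis-neg θ) ⟨
    cis θ +ℂ cis (- θ)               ∎

  module _ {θ : Carrier} (cosθ≈0 : cos θ ≈ 0#) where
    private
      w = cis θ

    -- The real part of w² is 2 (re w)² - |w|², where re w = 0 and |w|² = 1. Squaring makes the sign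
    -- of the sine irrelevant.
    cis²≈-1 : cis (θ + θ) ≈ℂ ℂR.- ℂR.1#
    cis²≈-1 = ℂR.trans (cis-+ θ θ) (re-eq , im-eq)
      where
      re≈0 : re w ≈ 0#
      re≈0 = trans (re-cis θ) cosθ≈0
      unit : re w * re w - im w * - im w ≈ 1#
      unit = proj₁ (cis*conj θ)
      re-eq : re w * re w - im w * im w ≈ - 1#
      re-eq = ≈-Reasoning.begin
        re w * re w - im w * im w
          ≈-Reasoning.≈⟨ solve 2 (λ a b → a :* a :- b :* b
               := con (+ 2) :* a :* a :- (a :* a :- b :* (:- b))) refl (re w) (im w) ⟩
        fromℕ 2 * re w * re w - (re w * re w - im w * - im w)
          ≈-Reasoning.≈⟨ +-cong (*-congˡ re≈0) (-‿cong unit) ⟩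
        fromℕ 2 * re w * 0# - 1#
          ≈-Reasoning.≈⟨ solve 2 (λ a e → a :* con 0ℤ :- e := :- e) refl (fromℕ 2 * re w) 1# ⟩
        - 1# ≈-Reasoning.∎
      im-eq : re w * im w + im w * re w ≈ - 0#
      im-eq = trans (+-cong (*-congʳ re≈0) (*-congˡ re≈0))
        (solve 1 (λ b → con 0ℤ :* b :+ b :* con 0ℤ := :- con 0ℤ) refl (im w))

    cis⁴≈1 : cis ((θ + θ) + (θ + θ)) ≈ℂ ℂR.1#
    cis⁴≈1 = begin
      cis ((θ + θ) + (θ + θ))                 ≈⟨ cis-+ (θ + θ) (θ + θ) ⟩
      cis (θ + θ) *ℂ cis (θ + θ)              ≈⟨ ℂR.*-cong cis²≈-1 cis²≈-1 ⟩
      (ℂR.- ℂR.1#) *ℂ (ℂR.- ℂR.1#)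
        ≈⟨ trans (solve 1 (λ e → (:- e) :* (:- e) :- (:- con 0ℤ) :* (:- con 0ℤ) := e :* e) refl 1#)
             (*-identityˡ 1#) ,
           solve 1 (λ e → (:- e) :* (:- con 0ℤ) :+ (:- con 0ℤ) :* (:- e) := con 0ℤ) refl 1# ⟩
      ℂR.1#                                   ∎

  -- χ n m  is  e^{2πim/n}.
  module Character (π : Carrier) (isPi : IsPi π) where

    cis-2π : cis (fromℕ 2 * π) ≈ℂ ℂR.1#
    cis-2π = ℂR.trans (cis-cong eq) (cis⁴≈1 {h} (IsPi.cos[π/2]≈0 isPi))
      where
      h = π * 1/ 2
      eq : fromℕ 2 * π ≈ (h + h) + (h + h)
      eq = ≈-Reasoning.begin
        fromℕ 2 * π                       ≈-Reasoning.≈⟨ *-identityʳ _ ⟨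
        fromℕ 2 * π * 1#                  ≈-Reasoning.≈⟨ *-congˡ (m*1/m 2) ⟨
        fromℕ 2 * π * (fromℕ 2 * 1/ 2)    ≈-Reasoning.≈⟨ solve 2 (λ p u →
                                              con (+ 2) :* p :* (con (+ 2) :* u)
                                              := (p :* u :+ p :* u) :+ (p :* u :+ p :* u)) refl π (1/ 2) ⟩
        (h + h) + (h + h)                 ≈-Reasoning.∎

    module _ (n : ℕ) .{{_ : NonZero n}} where

      χ : ℤ → ℂ
      χ m = cis (2π[ π ] m / n)

      χ-+ : ∀ a b → χ (a ℤ.+ b) ≈ℂ χ a *ℂ χ b
      χ-+ a b = ℂR.trans (cis-cong eq) (cis-+ (2π[ π ] a / n) (2π[ π ] b / n))
        where
        eq : 2π[ π ] (a ℤ.+ b) / n ≈ 2π[ π ] a / n + 2π[ π ] b / n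
        eq = trans (*-congʳ (*-congˡ (fromℤ-+ a b)))
          (solve 4 (λ t a b y → t :* (a :+ b) :* y := t :* a :* y :+ t :* b :* y) refl
            (fromℕ 2 * π) (fromℤ a) (fromℤ b) (1/ n))

      2π-neg : ∀ a → 2π[ π ] (ℤ.- a) / n ≈ - (2π[ π ] a / n)
      2π-neg a = trans (*-congʳ (*-congˡ (fromℤ-neg a)))
        (solve 3 (λ t a y → t :* (:- a) :* y := :- (t :* a :* y)) refl (fromℕ 2 * π) (fromℤ a) (1/ n))

      χ-neg : ∀ a → χ (ℤ.- a) ≈ℂ conj (χ a)
      χ-neg a = ℂR.trans (cis-cong (2π-neg a)) (cis-neg (2π[ π ] a / n))

      χ-0 : χ 0ℤ ≈ℂ ℂR.1#
      χ-0 = ℂR.trans (cis-cong (solve 2 (λ t y → t :* con 0ℤ :* y := con 0ℤ) refl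
        (fromℕ 2 * π) (1/ n))) exp-0

      χ-n : χ (+ n) ≈ℂ ℂR.1#
      χ-n = ℂR.trans
        (cis-cong (trans (*-assoc _ _ _) (trans (*-congˡ (m*1/m n)) (*-identityʳ _)))) cis-2π

      χ-ℕ-multiple : ∀ k → χ (+ k ℤ.* + n) ≈ℂ ℂR.1#
      χ-ℕ-multiple zero    = ℂR.trans (ℂR.reflexive (≡.cong χ (ℤ.*-zeroˡ (+ n)))) χ-0
      χ-ℕ-multiple (suc k) = begin
        χ (+ suc k ℤ.* + n)            ≡⟨ ≡.cong χ (ℤ.suc-* (+ k) (+ n)) ⟩
        χ (+ n ℤ.+ + k ℤ.* + n)        ≈⟨ χ-+ (+ n) (+ k ℤ.* + n) ⟩
        χ (+ n) *ℂ χ (+ k ℤ.* + n)     ≈⟨ ℂR.*-cong χ-n (χ-ℕ-multiple k) ⟩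
        ℂR.1# *ℂ ℂR.1#                 ≈⟨ ℂR.*-identityˡ ℂR.1# ⟩
        ℂR.1#                          ∎

      χ-multiple : ∀ a → χ (a ℤ.* + n) ≈ℂ ℂR.1#
      χ-multiple (+ k)    = χ-ℕ-multiple k
      χ-multiple -[1+ k ] = begin
        χ (-[1+ k ] ℤ.* + n)           ≡⟨ ≡.cong χ (ℤ.neg-distribˡ-* (+ suc k) (+ n)) ⟨
        χ (ℤ.- (+ suc k ℤ.* + n))      ≈⟨ χ-neg (+ suc k ℤ.* + n) ⟩
        conj (χ (+ suc k ℤ.* + n))     ≈⟨ conj-cong (χ-ℕ-multiple (suc k)) ⟩
        -- Every zeroth power is 1, so `conj-^` at exponent 0 says that 1 is its own conjugate.
        conj ℂR.1#                     ≈⟨ conj-^ 0ℂ 0 ⟩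
        ℂR.1#                          ∎

      -- `σ` returns a remainder modulo n. With b the quotient of that division, the remainder can
      -- be traded for r k itself.
      χ-mod : ∀ a b m → m ≡ a ℤ.+ b ℤ.* + n → χ m ≈ℂ χ a
      χ-mod a b m ≡.refl = begin
        χ (a ℤ.+ b ℤ.* + n)            ≈⟨ χ-+ a (b ℤ.* + n) ⟩
        χ a *ℂ χ (b ℤ.* + n)           ≈⟨ ℂR.*-congˡ (χ-multiple b) ⟩
        χ a *ℂ ℂR.1#                   ≈⟨ ℂR.*-identityʳ (χ a) ⟩
        χ a                            ∎

      2cosχ : ∀ m → ι (fromℕ 2 * cos (2π[ π ] m / n)) ≈ℂ χ m +ℂ χ (ℤ.- m)
      2cosχ m = ℂR.trans (2cos (2π[ π ] m / n)) (ℂR.+-congˡ {χ m} (cis-cong (sym (2π-neg m))))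

    -- Cancelling d in m d / (q d) carries the character modulo n, restricted to multiples of d, to
    -- the one in `ramanujanSum` modulo q.
    χ-reduce : ∀ q d .{{_ : NonZero q}} .{{_ : NonZero d}} .{{_ : NonZero (q ℕ.* d)}} m →
               χ (q ℕ.* d) (m ℤ.* + d) ≈ℂ χ q m
    χ-reduce q d m = cis-cong (≈-Reasoning.begin
      t * fromℤ (m ℤ.* + d) * 1/ (q ℕ.* d)
        ≈-Reasoning.≈⟨ *-congʳ (*-congˡ (fromℤ-* m (+ d))) ⟩
      t * (fromℤ m * fromℕ d) * 1/ (q ℕ.* d)
        ≈-Reasoning.≈⟨ trans (*-congˡ (m*1/m q)) (*-identityʳ _) ⟨
      t * (fromℤ m * fromℕ d) * 1/ (q ℕ.* d) * (fromℕ q * 1/ q)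
        ≈-Reasoning.≈⟨ solve 6 (λ t m d u q v → t :* (m :* d) :* u :* (q :* v)
             := t :* m :* v :* ((q :* d) :* u)) refl
             t (fromℤ m) (fromℕ d) (1/ (q ℕ.* d)) (fromℕ q) (1/ q) ⟩
      t * fromℤ m * 1/ q * ((fromℕ q * fromℕ d) * 1/ (q ℕ.* d))
        ≈-Reasoning.≈⟨ *-congˡ (trans (*-congʳ (sym (fromℕ-* q d))) (m*1/m (q ℕ.* d))) ⟩
      t * fromℤ m * 1/ q * 1#
        ≈-Reasoning.≈⟨ *-identityʳ _ ⟩
      t * fromℤ m * 1/ q ≈-Reasoning.∎)
      where t = fromℕ 2 * π

private module ℤ+ = GroupProperties (AbelianGroup.group ℤ.+-0-abelianGroup)

-- Laurent polynomials

-- It constrains every listed exponent, even where coefficients cancel, and so passes through `⊠`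
-- without collecting like terms.
Within : ℕ → Laurent → Set
Within B = All (λ (e , _) → ℤ.∣ e ∣ ℕ.≤ B)

within-⊠ : ∀ {A B} p q → Within A p → Within B q → Within (A ℕ.+ B) (p ⊠ q)
within-⊠ []            q []          q≤B = []
within-⊠ ((e , _) ∷ p) q (e≤A ∷ p≤A) q≤B = All.++⁺
  (All.map⁺ (All.map (λ {(e′ , _)} e′≤B →
    ℕ.≤-trans (ℤ.∣i+j∣≤∣i∣+∣j∣ e e′) (ℕ.+-mono-≤ e≤A e′≤B)) q≤B))
  (within-⊠ p q p≤A q≤B)

within-⊠^ : ∀ {B} p n → Within B p → Within (n ℕ.* B) (p ⊠^ n)
within-⊠^ p zero    p≤B = z≤n ∷ []
within-⊠^ p (suc n) p≤B = within-⊠ p (p ⊠^ n) p≤B (within-⊠^ p n p≤B)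

within-foldr : ∀ {m} (p : Fin m → Laurent) (B : Fin m → ℕ) → (∀ j → Within (B j) (p j)) →
               Within (foldr ℕ._+_ 0 B) (foldr _⊠_ (u^ 0ℤ) p)
within-foldr {zero}  p B p≤B = z≤n ∷ []
within-foldr {suc m} p B p≤B = within-⊠ (p Fin.zero) _ (p≤B Fin.zero)
  (within-foldr (p ∘ Fin.suc) (B ∘ Fin.suc) (p≤B ∘ Fin.suc))

coeff-∷ : ∀ M x p → coeff M (x ∷ p) ≡ coeff M (x ∷ []) ℤ.+ coeff M p
coeff-∷ M (e , c) p with e ℤ.≟ M
... | yes _ = ≡.cong (ℤ._+ coeff M p) (≡.sym (ℤ.+-identityʳ c))
... | no  _ = ≡.sym (ℤ.+-identityˡ _)

coeff-monomial-≡ : ∀ e c → coeff e ((e , c) ∷ []) ≡ c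
coeff-monomial-≡ e c with e ℤ.≟ e
... | yes _  = ℤ.+-identityʳ c
... | no e≢e = contradiction ≡.refl e≢e

coeff-monomial-≢ : ∀ {e M} c → e ≢ M → coeff M ((e , c) ∷ []) ≡ 0ℤ
coeff-monomial-≢ {e} {M} c e≢M with e ℤ.≟ M
... | yes e≡M = contradiction e≡M e≢M
... | no _    = ≡.refl

-- The index is e + B, computed in ℕ as m + B for e = m and as B ∸ (m + 1) for e = -(m + 1).
shifted-index : ∀ {e B} → ℤ.∣ e ∣ ℕ.≤ B → ∃[ i ] e ≡ + toℕ {suc (2 ℕ.* B)} i ℤ.- + B
shifted-index {e} {B} e≤B = let (k , k<1+2B , e≡k-B) = shift e e≤B in
  fromℕ< k<1+2B , ≡.trans e≡k-B (≡.cong (λ k → + k ℤ.- + B) (≡.sym (Fin.toℕ-fromℕ< k<1+2B)))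
  where
  cancel : ∀ e → (e ℤ.+ + B) ℤ.- + B ≡ e
  cancel e = ≡.trans (ℤ.+-assoc e (+ B) (ℤ.- + B))
    (≡.trans (≡.cong (λ z → e ℤ.+ z) (ℤ.+-inverseʳ (+ B))) (ℤ.+-identityʳ e))
  shift : ∀ e → ℤ.∣ e ∣ ℕ.≤ B → ∃[ k ] k ℕ.< suc (2 ℕ.* B) × e ≡ + k ℤ.- + B
  shift (+ m) m≤B = m ℕ.+ B ,
    s≤s (ℕ.+-mono-≤ m≤B (ℕ.≤-reflexive (≡.sym (ℕ.+-identityʳ B)))) , ≡.sym (cancel (+ m))
  shift -[1+ m ] m<B = B ℕ.∸ suc m , s≤s (ℕ.≤-trans (ℕ.m∸n≤m B (suc m)) (ℕ.m≤m+n B (B ℕ.+ 0))) ,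
    ≡.trans (≡.sym (cancel -[1+ m ])) (≡.cong (ℤ._- + B) (ℤ.⊖-≥ m<B))

-- Finite sums, and reindexing by greatest common divisors

module RangeSums {a ℓ} (M : CommutativeMonoid a ℓ) where

  open CommutativeMonoid M
    renaming (_∙_ to _+_; ε to 0#; ∙-cong to +-cong; ∙-congˡ to +-congˡ; ∙-congʳ to +-congʳ;
              identityˡ to +-identityˡ; identityʳ to +-identityʳ; assoc to +-assoc)
  open CommutativeMonoidSum M
  open SetoidReasoning setoid

  sum-zero : ∀ {n} (v : Fin n → Carrier) → (∀ i → v i ≈ 0#) → sum v ≈ 0#
  sum-zero {n} v v≈0 = trans (sum-cong-≋ v≈0) (sum-replicate-zero n)

  sum-single : ∀ {n} (v : Fin n → Carrier) i → (∀ j → j ≢ i → v j ≈ 0#) → sum v ≈ v i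
  sum-single {suc n} v i v≈0 = trans (sum-remove {i = i} v) (trans
    (+-congˡ (sum-zero _ (λ j → v≈0 (Fin.punchIn i j) (Fin.punchInᵢ≢i i j)))) (+-identityʳ (v i)))

  sumList : ∀ {x} {X : Set x} → (X → Carrier) → List X → Carrier
  sumList f xs = List.foldr _+_ 0# (List.map f xs)

  sumList-cong : ∀ {x} {X : Set x} {f g : X → Carrier} → (∀ k → f k ≈ g k) →
                 ∀ xs → sumList f xs ≈ sumList g xs
  sumList-cong f≈g []       = refl
  sumList-cong f≈g (k ∷ xs) = +-cong (f≈g k) (sumList-cong f≈g xs)

  sumList-comm : ∀ {x} {X : Set x} {n} (f : X → Fin n → Carrier) xs →
                 sumList (λ k → sum (f k)) xs ≈ sum (λ i → sumList (λ k → f k i) xs)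
  sumList-comm {n = n} f [] = sym (sum-zero {n} (λ _ → 0#) (λ _ → refl))
  sumList-comm f (k ∷ xs) = trans (+-congˡ (sumList-comm f xs)) (sym (∑-distrib-+ (f k) _))

  -- Replacing a filtered list by a full range with zero entries makes both sides of the reindexing
  -- sums over initial segments of ℕ.
  when : ∀ {p} {P : Set p} → Dec P → Carrier → Carrier
  when P? x = if does P? then x else 0#

  when-no : ∀ {p} {P : Set p} (P? : Dec P) x → ¬ P → when P? x ≈ 0#
  when-no (yes p) x ¬p = contradiction p ¬p
  when-no (no _)  x ¬p = refl

  when-cong : ∀ {p q} {P : Set p} {Q : Set q} (P? : Dec P) (Q? : Dec Q) {x y} →
              (P → Q) → (Q → P) → x ≈ y → when P? x ≈ when Q? y
  when-cong (yes p) (yes q) P→Q Q→P x≈y = x≈y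
  when-cong (yes p) (no ¬q) P→Q Q→P x≈y = contradiction (P→Q p) ¬q
  when-cong (no ¬p) (yes q) P→Q Q→P x≈y = contradiction (Q→P q) ¬p
  when-cong (no ¬p) (no ¬q) P→Q Q→P x≈y = refl

  sumList-filter : ∀ {x p} {X : Set x} {P : X → Set p} (P? : Decidable P)
    (f : X → Carrier) {n} (e : Fin n → X) →
    sumList f (List.filter P? (List.tabulate e)) ≈ sum (λ i → when (P? (e i)) (f (e i)))
  sumList-filter P? f {zero}  e = refl
  sumList-filter P? f {suc n} e with P? (e Fin.zero)
  ... | yes _ = +-congˡ (sumList-filter P? f (e ∘ Fin.suc))
  ... | no  _ = trans (sumList-filter P? f (e ∘ Fin.suc)) (sym (+-identityˡ _))

  ∑[_]< : (ℕ → Carrier) → ℕ → Carrier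
  ∑[ F ]< n = sum {n} (λ i → F (toℕ i))

  ∑<-+ : ∀ F m n → ∑[ F ]< (m ℕ.+ n) ≈ ∑[ F ]< m + ∑[ (λ i → F (m ℕ.+ i)) ]< n
  ∑<-+ F zero    n = sym (+-identityˡ _)
  ∑<-+ F (suc m) n = trans (+-congˡ (∑<-+ (F ∘ suc) m n)) (sym (+-assoc _ _ _))

  ∑<-* : ∀ F q d → ∑[ F ]< (q ℕ.* d) ≈ ∑[ (λ j → ∑[ (λ i → F (j ℕ.* d ℕ.+ i)) ]< d) ]< q
  ∑<-* F zero    d = refl
  ∑<-* F (suc q) d = trans (∑<-+ F d (q ℕ.* d)) (+-congˡ (trans
    (∑<-* (λ i → F (d ℕ.+ i)) q d)
    (sum-cong-≋ {q} (λ j → sum-cong-≋ {d} (λ i →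
      reflexive (≡.cong F (≡.sym (ℕ.+-assoc d (toℕ j ℕ.* d) (toℕ i)))))))))

  -- k ↦ k / d identifies the k with gcd(k, qd) = d with the residues prime to q.
  ∑-gcd : ∀ q d .{{_ : NonZero d}} (f : ℕ → Carrier) →
    ∑[ (λ k → when (ℕ.gcd k (q ℕ.* d) ℕ.≟ d) (f k)) ]< (q ℕ.* d) ≈
    ∑[ (λ u → when (ℕ.gcd u q ℕ.≟ 1) (f (u ℕ.* d))) ]< q
  ∑-gcd q d@(suc d-1) f = trans (∑<-* F q d) (sum-cong-≋ {q} (λ j → block (toℕ j)))
    where
    F : ℕ → Carrier
    F k = when (ℕ.gcd k (q ℕ.* d) ℕ.≟ d) (f k)
    gcd-scale : ∀ j → ℕ.gcd (j ℕ.* d ℕ.+ 0) (q ℕ.* d) ≡ d ℕ.* ℕ.gcd j q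
    gcd-scale j = ≡.trans
      (≡.cong₂ ℕ.gcd (≡.trans (ℕ.+-identityʳ (j ℕ.* d)) (ℕ.*-comm j d)) (ℕ.*-comm q d))
      (≡.sym (ℕ.c*gcd[m,n]≡gcd[cm,cn] d j q))
    -- If the gcd is d, then d divides j d + i and hence i, which is impossible for 0 < i < d. Each
    -- block of length d keeps only its first entry.
    non-multiple : ∀ j (i : Fin d) → i ≢ Fin.zero → F (j ℕ.* d ℕ.+ toℕ i) ≈ 0#
    non-multiple j Fin.zero    0≢0 = contradiction ≡.refl 0≢0
    non-multiple j (Fin.suc i) _   = when-no (ℕ.gcd m (q ℕ.* d) ℕ.≟ d) (f m) λ gcd≡d →
      ℕ.>⇒∤ (s≤s (Fin.toℕ<n i)) (ℕ.∣m+n∣m⇒∣n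
        (≡.subst (ℕ._∣ m) gcd≡d (ℕ.gcd[m,n]∣m m (q ℕ.* d))) (ℕ.n∣m*n j {d}))
      where m = j ℕ.* d ℕ.+ suc (toℕ i)
    block : ∀ j → ∑[ (λ i → F (j ℕ.* d ℕ.+ i)) ]< d ≈ when (ℕ.gcd j q ℕ.≟ 1) (f (j ℕ.* d))
    block j = trans
      (sum-single {d} (λ i → F (j ℕ.* d ℕ.+ toℕ i)) Fin.zero (non-multiple j))
      (when-cong (ℕ.gcd (j ℕ.* d ℕ.+ 0) (q ℕ.* d) ℕ.≟ d) (ℕ.gcd j q ℕ.≟ 1)
        (λ gcd≡d → ℕ.*-cancelˡ-≡ _ 1 d
          (≡.trans (≡.sym (gcd-scale j)) (≡.trans gcd≡d (≡.sym (ℕ.*-identityʳ d)))))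
        (λ gcd≡1 → ≡.trans (gcd-scale j) (≡.trans (≡.cong (d ℕ.*_) gcd≡1) (ℕ.*-identityʳ d)))
        (reflexive (≡.cong f (ℕ.+-identityʳ (j ℕ.* d)))))

  sumList-𝒪 : ∀ n d → d ℕ.< n → (f : ℕ → Carrier) →
    sumList (λ k → f ⟦ k ⟧) (𝒪 n d) ≈ ∑[ (λ k → when (ℕ.gcd k n ℕ.≟ d) (f k)) ]< n
  sumList-𝒪 n@(suc m) d d<n f = begin
    sumList (λ k → f ⟦ k ⟧) (List.filter P? (List.map mk (List.allFin m)))
      ≡⟨ ≡.cong (λ ks → sumList (λ k → f ⟦ k ⟧) (List.filter P? ks))
           (List.map-tabulate {n = m} (λ i → i) mk) ⟩
    sumList (λ k → f ⟦ k ⟧) (List.filter P? (List.tabulate mk))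
      ≈⟨ sumList-filter P? (λ k → f ⟦ k ⟧) mk ⟩
    sum {m} (λ i → when (P? (mk i)) (f (suc (toℕ i))))
      ≈⟨ +-identityˡ _ ⟨
    0# + sum {m} (λ i → when (P? (mk i)) (f (suc (toℕ i))))
      -- The range starts at 0 and `Ω n` at 1. The added entry vanishes because gcd(0, n) = n
      -- differs from d.
      ≈⟨ +-congʳ (when-no (ℕ.gcd 0 n ℕ.≟ d) (f 0) (λ n≡d → ℕ.<⇒≢ d<n (≡.sym n≡d))) ⟨
    ∑[ (λ k → when (ℕ.gcd k n ℕ.≟ d) (f k)) ]< n ∎
    where
    P? : Decidable (λ (k : Ω n) → ℕ.gcd ⟦ k ⟧ n ≡ d)
    P? k = ℕ.gcd ⟦ k ⟧ n ℕ.≟ d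
    mk : Fin m → Ω n
    mk i = mkΩ (suc (toℕ i)) (s≤s z≤n) (s≤s (Fin.toℕ<n i))

  𝒪↔units : ∀ q d .{{_ : NonZero d}} → d ℕ.< q ℕ.* d → (f : ℕ → Carrier) →
    sumList (λ k → f ⟦ k ⟧) (𝒪 (q ℕ.* d) d) ≈ sumList (λ u → f (toℕ u ℕ.* d)) (units q)
  𝒪↔units q d d<qd f = trans (sumList-𝒪 (q ℕ.* d) d d<qd f) (trans (∑-gcd q d f)
    (sym (sumList-filter (λ u → ℕ.gcd (toℕ u) q ℕ.≟ 1) (λ u → f (toℕ u ℕ.* d)) {q} (λ u → u))))

-- Evaluation of Laurent polynomials at a character of ℤ

module LaurentEvaluation {a ℓ} (R : CommutativeRing a ℓ)
  (χ : ℤ → CommutativeRing.Carrier R)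
  (χ-+ : ∀ i j → CommutativeRing._≈_ R (χ (i ℤ.+ j)) (CommutativeRing._*_ R (χ i) (χ j)))
  (χ-0 : CommutativeRing._≈_ R (χ 0ℤ) (CommutativeRing.1# R)) where

  open CommutativeRing R
  open FromInteger R
  open RawSemiringDefs (Semiring.rawSemiring semiring) using (_^_; product)
  open CommutativeSemigroupProperties (CommutativeMonoid.commutativeSemigroup *-commutativeMonoid)
    using (interchange)
  open RangeSums +-commutativeMonoid using (sum-zero; sum-single)
  open SemiringSum semiring using (sum; ∑-distrib-+; sum-cong-≋)
  open SetoidReasoning setoid

  -- The homomorphism `χ` supplies the powers of u at all integer exponents, so inverses and integer
  -- powers need no definition in the ring.
  eval : Laurent → Carrier
  eval []            = 0#
  eval ((e , c) ∷ p) = fromℤ c * χ e + eval p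

  eval-⊞ : ∀ p q → eval (p ⊞ q) ≈ eval p + eval q
  eval-⊞ []            q = sym (+-identityˡ _)
  eval-⊞ ((e , c) ∷ p) q = trans (+-congˡ (eval-⊞ p q)) (sym (+-assoc _ _ _))

  eval-shift : ∀ e c q → eval (List.map (λ (e′ , c′) → e ℤ.+ e′ , c ℤ.* c′) q) ≈ fromℤ c * χ e * eval q
  eval-shift e c []              = sym (zeroʳ _)
  eval-shift e c ((e′ , c′) ∷ q) = begin
    fromℤ (c ℤ.* c′) * χ (e ℤ.+ e′) + eval (List.map _ q)
      ≈⟨ +-cong (*-cong (fromℤ-* c c′) (χ-+ e e′)) (eval-shift e c q) ⟩
    fromℤ c * fromℤ c′ * (χ e * χ e′) + fromℤ c * χ e * eval q
      ≈⟨ +-congʳ (interchange (fromℤ c) (fromℤ c′) (χ e) (χ e′)) ⟩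
    fromℤ c * χ e * (fromℤ c′ * χ e′) + fromℤ c * χ e * eval q
      ≈⟨ distribˡ _ _ _ ⟨
    fromℤ c * χ e * (fromℤ c′ * χ e′ + eval q) ∎

  eval-⊠ : ∀ p q → eval (p ⊠ q) ≈ eval p * eval q
  eval-⊠ []            q = sym (zeroˡ _)
  eval-⊠ ((e , c) ∷ p) q = trans (eval-⊞ (List.map _ q) (p ⊠ q))
    (trans (+-cong (eval-shift e c q) (eval-⊠ p q)) (sym (distribʳ (eval q) _ _)))

  eval-u^ : ∀ e → eval (u^ e) ≈ χ e
  eval-u^ e = trans (+-identityʳ _) (trans (*-congʳ (+-identityʳ 1#)) (*-identityˡ (χ e)))

  eval-⊠^ : ∀ p n → eval (p ⊠^ n) ≈ eval p ^ n
  eval-⊠^ p zero    = trans (eval-u^ 0ℤ) χ-0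
  eval-⊠^ p (suc n) = trans (eval-⊠ p (p ⊠^ n)) (*-congˡ (eval-⊠^ p n))

  eval-foldr : ∀ {m} (p : Fin m → Laurent) → eval (foldr _⊠_ (u^ 0ℤ) p) ≈ product (λ j → eval (p j))
  eval-foldr {zero}  p = trans (eval-u^ 0ℤ) χ-0
  eval-foldr {suc m} p = trans (eval-⊠ (p Fin.zero) _) (*-congˡ (eval-foldr (p ∘ Fin.suc)))

  -- Both sides are additive in p, which leaves a single monomial. Its exponent lies in the range
  -- and is hit by exactly one index, so one summand survives.
  eval-coeff : ∀ {B} p → Within B p →
    eval p ≈ sum {suc (2 ℕ.* B)} (λ i → let M = + toℕ i ℤ.- + B in fromℤ (coeff M p) * χ M)
  eval-coeff {B} []              []          = sym (sum-zero {suc (2 ℕ.* B)}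
    (λ i → fromℤ 0ℤ * χ (+ toℕ i ℤ.- + B)) (λ i → zeroˡ _))
  eval-coeff {B} (x@(e , c) ∷ p) (e≤B ∷ p≤B) = begin
    fromℤ c * χ e + eval p
      ≈⟨ +-cong (sym monomial) (eval-coeff p p≤B) ⟩
    sum {suc (2 ℕ.* B)} (term (x ∷ [])) + sum {suc (2 ℕ.* B)} (term p)
      ≈⟨ ∑-distrib-+ {suc (2 ℕ.* B)} (term (x ∷ [])) (term p) ⟨
    sum {suc (2 ℕ.* B)} (λ i → term (x ∷ []) i + term p i)
      ≈⟨ sum-cong-≋ {suc (2 ℕ.* B)} split ⟨
    sum {suc (2 ℕ.* B)} (term (x ∷ p)) ∎
    where
    exponent : Fin (suc (2 ℕ.* B)) → ℤ
    exponent i = + toℕ i ℤ.- + B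
    term : Laurent → Fin (suc (2 ℕ.* B)) → Carrier
    term p i = fromℤ (coeff (exponent i) p) * χ (exponent i)
    split : ∀ i → term (x ∷ p) i ≈ term (x ∷ []) i + term p i
    split i = trans (*-congʳ (trans (reflexive (≡.cong fromℤ (coeff-∷ (exponent i) x p)))
      (fromℤ-+ (coeff (exponent i) (x ∷ [])) (coeff (exponent i) p)))) (distribʳ _ _ _)
    i₀ : Fin (suc (2 ℕ.* B))
    i₀ = proj₁ (shifted-index {e} e≤B)
    e≡ : e ≡ exponent i₀
    e≡ = proj₂ (shifted-index {e} e≤B)
    exponent-injective : ∀ {i j} → exponent i ≡ exponent j → i ≡ j
    exponent-injective {i} {j} eq = Fin.toℕ-injective (ℤ.+-injective
      (ℤ+.∙-cancelʳ (ℤ.- + B) (+ toℕ i) (+ toℕ j) eq))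
    monomial : sum {suc (2 ℕ.* B)} (term (x ∷ [])) ≈ fromℤ c * χ e
    monomial = trans
      (sum-single {suc (2 ℕ.* B)} (term (x ∷ [])) i₀ (λ j j≢i₀ → trans
        (*-congʳ (reflexive (≡.cong fromℤ (coeff-monomial-≢ c
          (λ e≡j → j≢i₀ (exponent-injective (≡.trans (≡.sym e≡j) e≡)))))))
        (zeroˡ _)))
      (reflexive (≡.trans
        (≡.cong (λ M → fromℤ (coeff M (x ∷ [])) * χ M) (≡.sym e≡))
        (≡.cong (λ z → fromℤ z * χ e) (coeff-monomial-≡ e c))))

-- Cosine products as character sums, and the theorem

open import Data.Nat.Base using (_<_)

module CosineSums {c ℓ₁ ℓ₂} (ℝ : CompleteOrderedField c ℓ₁ ℓ₂)
  (π : CompleteOrderedField.Carrier ℝ) (isPi : Analysis.IsPi ℝ π) where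

  open Analysis ℝ hiding (_<_)
  open Exponential ℝ
  open Circle ℝ
  open Character π isPi
  open CommutativeRing commutativeRing using (semiring; +-commutativeMonoid)
  open FromInteger commutativeRing using (module Solver)
  open Solver using (solve; con; :-_; _:=_)
  open RawSemiringDefs (Semiring.rawSemiring semiring) using (_^_; product)
  open RawSemiringDefs (Semiring.rawSemiring ℂR.semiring) using () renaming (product to productℂ)
  private
    module ℂℤ = FromInteger ℂ-commutativeRing
    module ℂ∏ = CommutativeMonoidSum ℂR.*-commutativeMonoid
    module ℝ∑ = RangeSums +-commutativeMonoid
  open RangeSums ℂR.+-commutativeMonoid using (sumList; sumList-cong; sumList-comm; 𝒪↔units)
  open SetoidReasoning ℂR.setoid

  ι-fromℕ : ∀ n → ι (fromℕ n) ≈ℂ ℂℤ.fromℕ n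
  ι-fromℕ zero    = ℂR.refl
  ι-fromℕ (suc n) = ℂR.trans (ι-+ 1# (fromℕ n)) (ℂR.+-congˡ {ℂR.1#} (ι-fromℕ n))

  -- `eval` takes its integers in the ring ℂ, the theorem embeds real integers by `ι`; the two must
  -- be reconciled.
  ι-fromℤ : ∀ i → ι (fromℤ i) ≈ℂ ℂℤ.fromℤ i
  ι-fromℤ (+ n)    = ι-fromℕ n
  ι-fromℤ -[1+ n ] = ℂR.trans (refl , solve 0 (con 0ℤ := :- con 0ℤ) refl) (ℂR.-‿cong (ι-fromℕ (suc n)))

  ι-product : ∀ {m} (v : Fin m → Carrier) → ι (product v) ≈ℂ productℂ (λ j → ι (v j))
  ι-product {zero}  v = ℂR.refl
  ι-product {suc m} v = ℂR.trans (ι-* (v Fin.zero) (product (v ∘ Fin.suc)))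
    (ℂR.*-congˡ {ι (v Fin.zero)} (ι-product (v ∘ Fin.suc)))

  ι-sumList : ∀ {x} {X : Set x} (f : X → Carrier) xs → ι (ℝ∑.sumList f xs) ≈ℂ sumList (λ k → ι (f k)) xs
  ι-sumList f []       = ℂR.refl
  ι-sumList f (k ∷ xs) = ℂR.trans (ι-+ (f k) (ℝ∑.sumList f xs)) (ℂR.+-congˡ {ι (f k)} (ι-sumList f xs))

  *-sumList : ∀ {x} {X : Set x} z (f : X → ℂ) xs → sumList (λ k → z *ℂ f k) xs ≈ℂ z *ℂ sumList f xs
  *-sumList z f []       = ℂR.sym (ℂR.zeroʳ z)
  *-sumList z f (k ∷ xs) = ℂR.trans (ℂR.+-congˡ {z *ℂ f k} (*-sumList z f xs))
    (ℂR.sym (ℂR.distribˡ z (f k) (sumList f xs)))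

  module _ (n : ℕ) .{{_ : NonZero n}} (k : Ω n) where

    -- `ψ m` stands for the power u^m at u = χₙ(k).
    ψ : ℤ → ℂ
    ψ m = χ n (m ℤ.* + ⟦ k ⟧)

    ψ-+ : ∀ a b → ψ (a ℤ.+ b) ≈ℂ ψ a *ℂ ψ b
    ψ-+ a b = ℂR.trans (ℂR.reflexive (≡.cong (χ n) (ℤ.*-distribʳ-+ (+ ⟦ k ⟧) a b)))
      (χ-+ n (a ℤ.* + ⟦ k ⟧) (b ℤ.* + ⟦ k ⟧))

    ψ-0 : ψ 0ℤ ≈ℂ ℂR.1#
    ψ-0 = ℂR.trans (ℂR.reflexive (≡.cong (χ n) (ℤ.*-zeroˡ (+ ⟦ k ⟧)))) (χ-0 n)

    open LaurentEvaluation ℂ-commutativeRing ψ ψ-+ ψ-0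

    -- Periodicity replaces the remainder s by r k in the first summand; conjugation transfers this
    -- to the second, where -s need not be a remainder.
    2cos-σ : ∀ r .(coprime : gcd r (+ n) ≡ 1ℤ) →
      ι (fromℕ 2 * cos (2π[ π ] (+ ⟦ σ r coprime k ⟧) / n)) ≈ℂ eval (u^ r ⊞ u^ (ℤ.- r))
    2cos-σ r coprime = begin
      ι (fromℕ 2 * cos (2π[ π ] s / n))   ≈⟨ 2cosχ n s ⟩
      χ n s +ℂ χ n (ℤ.- s)                ≈⟨ ℂR.+-congˡ {χ n s} (χ-neg n s) ⟩
      χ n s +ℂ conj (χ n s)               ≈⟨ ℂR.+-cong χ≈ (conj-cong χ≈) ⟨
      ψ r +ℂ conj (ψ r)                   ≈⟨ ℂR.+-congˡ {ψ r} (χ-neg n (r ℤ.* + ⟦ k ⟧)) ⟨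
      ψ r +ℂ χ n (ℤ.- (r ℤ.* + ⟦ k ⟧))    ≡⟨ ≡.cong (λ m → ψ r +ℂ χ n m) (ℤ.neg-distribˡ-* r (+ ⟦ k ⟧)) ⟩
      ψ r +ℂ ψ (ℤ.- r)                    ≈⟨ ℂR.+-cong (eval-u^ r) (eval-u^ (ℤ.- r)) ⟨
      eval (u^ r) +ℂ eval (u^ (ℤ.- r))    ≈⟨ eval-⊞ (u^ r) (u^ (ℤ.- r)) ⟨
      eval (u^ r ⊞ u^ (ℤ.- r))            ∎
      where
      s = + ((r ℤ.* + ⟦ k ⟧) ℤ.%ℕ n)
      χ≈ : ψ r ≈ℂ χ n s
      χ≈ = χ-mod n s ((r ℤ.* + ⟦ k ⟧) ℤ./ℕ n) (r ℤ.* + ⟦ k ⟧) (ℤ.a≡a%ℕn+[a/ℕn]*n (r ℤ.* + ⟦ k ⟧) n)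

    product-2cos-σ : ∀ (P : Pattern) (let open Pattern P) .(coprime : ∀ j → gcd (r j) (+ n) ≡ 1ℤ) →
      ι (product (λ j → (fromℕ 2 * cos (2π[ π ] (+ ⟦ σ (r j) (coprime j) k ⟧) / n)) ^ h j)) ≈ℂ
      ∑± (bound P) (λ M → ι (fromℤ (𝖲 P M)) *ℂ ψ M)
    product-2cos-σ P coprime = begin
      ι (product (λ j → x j ^ h j))
        ≈⟨ ι-product (λ j → x j ^ h j) ⟩
      productℂ (λ j → ι (x j ^ h j))
        -- `ℂ∏` is the theory of finite sums at the multiplicative monoid, so its sums are products.
        ≈⟨ ℂ∏.sum-cong-≋ (λ j → ℂR.trans (ι-^ (x j) (h j)) (^ℂ-cong (h j) (2cos-σ (r j) (coprime j)))) ⟩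
      productℂ (λ j → eval (p j) ^ℂ h j)
        ≈⟨ ℂ∏.sum-cong-≋ (λ j → eval-⊠^ (p j) (h j)) ⟨
      productℂ (λ j → eval (p j ⊠^ h j))
        ≈⟨ eval-foldr (λ j → p j ⊠^ h j) ⟨
      eval (foldr _⊠_ (u^ 0ℤ) (λ j → p j ⊠^ h j))
        -- The jth factor has exponents within h j · |r j|, and `bound P` is by definition the total
        -- of these.
        ≈⟨ eval-coeff {bound P} _ (within-foldr (λ j → p j ⊠^ h j) (λ j → h j ℕ.* ℤ.∣ r j ∣)
             (λ j → within-⊠^ (p j) (h j) (p-within j))) ⟩
      ∑± (bound P) (λ M → ℂℤ.fromℤ (𝖲 P M) *ℂ ψ M)
        ≈⟨ ℂΣ.sum-cong-≋ {suc (2 ℕ.* bound P)} (λ i → let M = + toℕ i ℤ.- + bound P in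
             ℂR.*-congʳ {ψ M} (ι-fromℤ (𝖲 P M))) ⟨
      ∑± (bound P) (λ M → ι (fromℤ (𝖲 P M)) *ℂ ψ M) ∎
      where
      open Pattern P
      x : Fin (suc t-1) → Carrier
      x j = fromℕ 2 * cos (2π[ π ] (+ ⟦ σ (r j) (coprime j) k ⟧) / n)
      p : Fin (suc t-1) → Laurent
      p j = u^ (r j) ⊞ u^ (ℤ.- r j)
      p-within : ∀ j → Within ℤ.∣ r j ∣ (p j)
      p-within j = ℕ.≤-refl ∷ ℕ.≤-reflexive (ℤ.∣-i∣≡∣i∣ (r j)) ∷ []

  sum-χ-𝒪 : ∀ q d .{{_ : NonZero q}} .{{_ : NonZero d}} .{{_ : NonZero (q ℕ.* d)}} → d < q ℕ.* d → ∀ M →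
    sumList (λ k → χ (q ℕ.* d) (M ℤ.* + ⟦ k ⟧)) (𝒪 (q ℕ.* d) d) ≈ℂ ramanujanSum π q M
  sum-χ-𝒪 q d d<qd M = ℂR.trans
    (𝒪↔units q d d<qd (λ k → χ (q ℕ.* d) (M ℤ.* + k)))
    (sumList-cong (λ u → ℂR.trans (ℂR.reflexive (≡.cong (χ (q ℕ.* d)) (eq (toℕ u))))
      (χ-reduce q d (M ℤ.* + toℕ u))) (units q))
    where
    eq : ∀ u → M ℤ.* + (u ℕ.* d) ≡ M ℤ.* + u ℤ.* + d
    eq u = ≡.trans (≡.cong (λ z → M ℤ.* z) (ℤ.pos-* u d)) (≡.sym (ℤ.*-assoc M (+ u) (+ d)))

proposition4p9 : ∀ {c ℓ₁ ℓ₂} (ℝ : CompleteOrderedField c ℓ₁ ℓ₂)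
    (π : CompleteOrderedField.Carrier ℝ) → Analysis.IsPi ℝ π →
    let open Analysis ℝ hiding (_<_) in
    (P : Pattern) (n : ℕ) .{{_ : NonTrivial n}}
    (coprime : gcd (+ n) (∏ℤ (Pattern.r P)) ≡ 1ℤ)
    (d : ℕ) .{{_ : NonZero d}} (d∣n : d ∣ n) → d < n →
    let q = quotient d∣n in
    ι (𝖳 P n d coprime (α π n))
    ≈ℂ ∑± (bound P) (λ M → ι (fromℤ (𝖲 P M)) *ℂ ramanujanSum π q {{quotient≢0 d∣n}} M)
-- Matching on `≡.refl` turns n into the product `q * d`, the form in which `sum-χ-𝒪` applies.
proposition4p9 ℝ π isPi P n coprime d d∣n@(divides q ≡.refl) d<n = begin
  ι (𝖳 P n d coprime (α π n))
    ≈⟨ ι-sumList term (𝒪 n d) ⟩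
  sumList (λ k → ι (term k)) (𝒪 n d)
    ≈⟨ sumList-cong (λ k → product-2cos-σ n k P (coprime-factor n r coprime)) (𝒪 n d) ⟩
  sumList (λ k → ∑± B (λ M → S M *ℂ ψ n k M)) (𝒪 n d)
    ≈⟨ sumList-comm {n = suc (2 ℕ.* B)} (λ k i → S (M i) *ℂ ψ n k (M i)) (𝒪 n d) ⟩
  ∑± B (λ M → sumList (λ k → S M *ℂ ψ n k M) (𝒪 n d))
    ≈⟨ ℂΣ.sum-cong-≋ {suc (2 ℕ.* B)} (λ i → ℂR.trans
         (*-sumList (S (M i)) (λ k → ψ n k (M i)) (𝒪 n d))
         (ℂR.*-congˡ {S (M i)} (sum-χ-𝒪 q d d<n (M i)))) ⟩
  ∑± B (λ M → S M *ℂ ramanujanSum π q M) ∎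
  where
  open Analysis ℝ hiding (_<_)
  open Exponential ℝ using (module ℂR; module ℂΣ)
  open CosineSums ℝ π isPi
  open CommutativeRing commutativeRing using (semiring)
  open RawSemiringDefs (Semiring.rawSemiring semiring) using (_^_; product)
  open RangeSums ℂR.+-commutativeMonoid using (sumList; sumList-cong; sumList-comm)
  open Pattern P
  open SetoidReasoning ℂR.setoid
  instance
    n≢0 = ℕ.nonTrivial⇒nonZero n
    q≢0 = quotient≢0 d∣n
  B = bound P
  S : ℤ → ℂ
  S M = ι (fromℤ (𝖲 P M))
  M : Fin (suc (2 ℕ.* B)) → ℤ
  M i = + toℕ i ℤ.- + B
  term : Ω n → Carrier
  term k = product (λ j → (fromℕ 2 * α π n (σ (r j) (coprime-factor n r coprime j) k)) ^ h j)
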